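{- Let $A\in\mathbb{R}^{m\times n}$ be non-degenerate, $p>0$, $w=w_p(A)$, $W=\mathrm{Diag}(w)$, and define $$E=\{x\in\mathbb{R}^n:x^\top A^\top WAx\le1\}\quad\text{and}\quad K=\{x\in\mathbb{R}^n:\|Ax\|_\infty\le1\}.$$ Then $R:=\max_{i\in[m]}\sigma(W^{\frac12}A)_iw_i^{ -1}$ is the smallest value such that $E\subseteq\sqrt R\,K$. Further, $K\subseteq\sqrt n\,E$, and hence, with $C=c_{p,\infty,m}$, the ellipsoid $C^{ -1/2}E$ is a $\sqrt{C\,n}$-rounding of $K$, i.e. $C^{ -1/2}E\subseteq K\subseteq\sqrt{Cn}\,(C^{ -1/2}E)$.
   Context: A matrix is non-degenerate if it has full column rank and no zero rows. For non-degenerate $B$, $\sigma(B)=\mathrm{diag}(B(B^\top B)^{ -1}B^\top)$ (leverage scores). The $\ell_p$ Lewis weight $w_p(A)$ is the unique $w\in\mathbb{R}^m_{>0}$ with $w=\sigma(W^{\frac12-\frac1p}A)$, $W=\mathrm{Diag}(w)$. The constant is $c_{p,\infty,m}=(1+\alpha)^{\frac1{1+\alpha}}\big((1+\frac1\alpha)m\big)^{\frac\alpha{1+\alpha}}$ with $\alpha=\frac2p$. An ellipsoid $F$ is a $\nu$-rounding of $K$ if $F\subseteq K\subseteq\nu F$. -}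

module Defs where

open import Level using (0ℓ)
open import Algebra.Bundles using (CommutativeRing)
import Algebra.Definitions as AlgebraDefinitions
import Algebra.Construct.NaturalChoice.Max as Max
import Algebra.Solver.Ring.NaturalCoefficients.Default as SemiringSolver
import Algebra.Properties.Group as GroupProperties
import Algebra.Properties.Ring as RingProperties
import Algebra.Properties.Monoid.Mult as MonoidMult
import Algebra.Properties.Semiring.Sum as SemiringSum
open import Data.Bool.Base using (if_then_else_)
open import Data.Fin.Base using (Fin; zero; suc)
open import Data.Fin.Properties using (_≟_)
open import Data.Nat.Base using (ℕ; zero; suc)
open import Data.Product.Base using (_×_; _,_; proj₁; proj₂; ∃)
open import Data.Sum.Base using (inj₁; inj₂)
open import Data.Vec.Functional using (Vector; _∷_; head; tail)
import Data.Vec.Functional.Relation.Binary.Equality.Setoid as VectorEquality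
open import Relation.Binary.Bundles using (TotalOrder)
open import Relation.Binary.Core using (Rel)
open import Relation.Binary.Structures using (IsDecTotalOrder)
open import Relation.Nullary using (¬_; yes; no; does)
open import Relation.Unary using (Pred; _⊆_; _≐_)

-- The classical real numbers, axiomatised as a Dedekind-complete linearly
-- ordered field, hence unique up to isomorphism.  The axioms are classical:
-- the order is decidable and every inhabited bounded predicate has a supremum,
-- so inhabiting this record requires a form of
-- excluded middle.
record CompleteOrderedField : Set₁ where
  infix  4 _≤_ _<_
  infix  8 _⁻¹

  field
    commutativeRing : CommutativeRing 0ℓ 0ℓ

  open CommutativeRing commutativeRing public

  field
    _≤_             : Rel Carrier 0ℓ
    isDecTotalOrder : IsDecTotalOrder _≈_ _≤_
    +-monoˡ-≤       : ∀ {x y} z → x ≤ y → x + z ≤ y + z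
    *-nonneg        : ∀ {x y} → 0# ≤ x → 0# ≤ y → 0# ≤ x * y

    -- Total for convenience; nothing beyond congruence is assumed at 0#.
    _⁻¹             : Carrier → Carrier
    ⁻¹-cong         : ∀ {x y} → x ≈ y → x ⁻¹ ≈ y ⁻¹
    *-inverseʳ      : ∀ {x} → ¬ (x ≈ 0#) → x * x ⁻¹ ≈ 1#
    0≉1             : ¬ (0# ≈ 1#)

  _<_ : Rel Carrier 0ℓ
  x < y = x ≤ y × ¬ (x ≈ y)

  IsUpperBound : Pred Carrier 0ℓ → Pred Carrier 0ℓ
  IsUpperBound S u = ∀ {x} → S x → x ≤ u

  IsLeast : Pred Carrier 0ℓ → Pred Carrier 0ℓ
  IsLeast S l = S l × (∀ {x} → S x → l ≤ x)

  field
    complete : (S : Pred Carrier 0ℓ) → ∃ S → ∃ (IsUpperBound S) →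
               ∃ (IsLeast (IsUpperBound S))

  open IsDecTotalOrder isDecTotalOrder public
    using (_≤?_; total; ≤-respˡ-≈; ≤-respʳ-≈)
    renaming ( refl to ≤-refl; reflexive to ≤-reflexive; trans to ≤-trans
             ; antisym to ≤-antisym; _≟_ to _≈?_)

  totalOrder : TotalOrder 0ℓ 0ℓ 0ℓ
  totalOrder = record
    { isTotalOrder = IsDecTotalOrder.isTotalOrder isDecTotalOrder }

-- Real exponentiation.  Positivity, additivity in the exponent, `^-one` and
-- monotonicity already determine x ^ a for 0 < x; `^-*` and `^-distrib` are
-- redundant.  Apart from congruence, nothing is assumed about negative bases,
-- nor about 0# ^ a unless 0 < a.
record RealPower (F : CompleteOrderedField) : Set where
  open CompleteOrderedField F
  infixr 9 _^_

  field
    _^_        : Carrier → Carrier → Carrier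
    ^-cong     : ∀ {x y a b} → x ≈ y → a ≈ b → x ^ a ≈ y ^ b
    ^-pos      : ∀ {x} a → 0# < x → 0# < x ^ a
    ^-one      : ∀ {x} → 0# < x → x ^ 1# ≈ x
    ^-+        : ∀ {x} a b → 0# < x → x ^ (a + b) ≈ x ^ a * x ^ b
    ^-*        : ∀ {x} a b → 0# < x → x ^ (a * b) ≈ (x ^ a) ^ b
    ^-distrib  : ∀ {x y} a → 0# < x → 0# < y → (x * y) ^ a ≈ x ^ a * y ^ a
    ^-monoʳ-≤  : ∀ {x a b} → 1# ≤ x → a ≤ b → x ^ a ≤ x ^ b
    0^         : ∀ {a} → 0# < a → 0# ^ a ≈ 0#

record RealNumbers : Set₁ where
  field
    completeOrderedField : CompleteOrderedField
    realPower            : RealPower completeOrderedField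

  open CompleteOrderedField completeOrderedField public
  open RealPower realPower public

module Matrices (ℝ : RealNumbers) where
  open RealNumbers ℝ hiding (zero)
  open MonoidMult +-monoid using () renaming (_×_ to _times_)
  open Max totalOrder public using (_⊔_)
  open SemiringSum semiring using (sum; sum-cong-≋; sum-replicate-zero; ∑-comm)
  open SemiringSum semiring using (*-distribˡ-sum; *-distribʳ-sum)
  open RingProperties ring using (-1*x≈-x; -‿distribˡ-*; -‿distribʳ-*; -‿involutive)
  open GroupProperties +-group using () renaming (x∙y⁻¹≈ε⇒x≈y to x-y≈0⇒x≈y)
  open import Relation.Binary.Reasoning.Setoid setoid
  open SemiringSolver commutativeSemiring using (solve; _:+_; _:*_; _:=_)

  infixl 7 _∙_ _⊡_ _⊛_
  infix  8 _ᵀ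
  infix  4 _≋ₘ_

  2# ½ : Carrier
  2# = 1# + 1#
  ½  = 2# ⁻¹

  √ : Carrier → Carrier
  √ x = x ^ ½

  ∣_∣ : Carrier → Carrier
  ∣ x ∣ = x ⊔ (- x)

  fromℕ : ℕ → Carrier
  fromℕ k = k times 1#

  ℝ^ : ℕ → Set
  ℝ^ n = Vector Carrier n

  Matrix : ℕ → ℕ → Set
  Matrix m n = Vector (ℝ^ n) m

  open VectorEquality setoid public using (_≋_)

  _≋ₘ_ : ∀ {m n} → Rel (Matrix m n) 0ℓ
  M ≋ₘ N = ∀ i → M i ≋ N i

  𝟎 : ∀ {n} → ℝ^ n
  𝟎 _ = 0#

  _∙_ : ∀ {n} → ℝ^ n → ℝ^ n → Carrier
  x ∙ y = sum (λ i → x i * y i)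

  _ᵀ : ∀ {m n} → Matrix m n → Matrix n m
  (M ᵀ) i j = M j i

  _⊛_ : ∀ {m n} → Matrix m n → ℝ^ n → ℝ^ m
  (M ⊛ x) i = M i ∙ x

  _⊡_ : ∀ {l m n} → Matrix l m → Matrix m n → Matrix l n
  (M ⊡ N) i j = M i ∙ (N ᵀ) j

  Diag : ∀ {n} → ℝ^ n → Matrix n n
  Diag v i j = if does (i ≟ j) then v i else 0#

  diag : ∀ {n} → Matrix n n → ℝ^ n
  diag M i = M i i

  Id : ∀ {n} → Matrix n n
  Id = Diag (λ _ → 1#)

  Invertible : ∀ {n} → Matrix n n → Set
  Invertible = AlgebraDefinitions.Invertible _≋ₘ_ Id _⊡_

  max : ∀ {k} → ℝ^ (suc k) → Carrier
  max {zero}  x = head x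
  max {suc k} x = head x ⊔ max (tail x)

  ∥_∥∞ : ∀ {k} → ℝ^ (suc k) → Carrier
  ∥ x ∥∞ = max (λ i → ∣ x i ∣)

  quad : ∀ {n} → Matrix n n → ℝ^ n → Carrier
  quad M x = x ∙ (M ⊛ x)

  PositiveDefinite : ∀ {n} → Matrix n n → Set
  PositiveDefinite M =
    ((M ᵀ) ≋ₘ M) × (∀ x → ¬ (x ≋ 𝟎) → 0# < quad M x)

  FullColumnRank : ∀ {m n} → Matrix m n → Set
  FullColumnRank M = ∀ x → M ⊛ x ≋ 𝟎 → x ≋ 𝟎

  NonDegenerate : ∀ {m n} → Matrix m n → Set
  NonDegenerate M = FullColumnRank M × (∀ i → ¬ (M i ≋ 𝟎))

  gram : ∀ {m n} → Matrix m n → Matrix n n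
  gram B = B ᵀ ⊡ B

  -- Gram matrices of full column rank are inverted by elimination.  Each pivot is nonzero because the quadratic form vanishes only at 0.

  ∙-cong : ∀ {n} {x x′ y y′ : ℝ^ n} → x ≋ x′ → y ≋ y′ → x ∙ y ≈ x′ ∙ y′
  ∙-cong p q = sum-cong-≋ (λ i → *-cong (p i) (q i))

  ∙-zeroˡ : ∀ {n} (y : ℝ^ n) → 𝟎 ∙ y ≈ 0#
  ∙-zeroˡ {n} y = trans (sum-cong-≋ (λ i → zeroˡ (y i))) (sum-replicate-zero n)

  ∙-comm : ∀ {n} (x y : ℝ^ n) → x ∙ y ≈ y ∙ x
  ∙-comm x y = sum-cong-≋ (λ i → *-comm (x i) (y i))

  ∙-zeroʳ : ∀ {n} (x : ℝ^ n) → x ∙ 𝟎 ≈ 0#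
  ∙-zeroʳ x = trans (∙-comm x 𝟎) (∙-zeroˡ x)

  ∙-linearˡ : ∀ {n} (d v y : ℝ^ n) u →
              (λ j → d j + u * v j) ∙ y ≈ d ∙ y + u * (v ∙ y)
  ∙-linearˡ {zero}  d v y u = sym (trans (+-identityˡ _) (zeroʳ u))
  ∙-linearˡ {suc n} d v y u = trans
    (+-congˡ (∙-linearˡ (tail d) (tail v) (tail y) u))
    (solve 6 (λ d₀ v₀ y₀ u p q →
        ((d₀ :+ u :* v₀) :* y₀ :+ (p :+ u :* q))
      := ((d₀ :* y₀ :+ p) :+ u :* (v₀ :* y₀ :+ q)))
      refl (d zero) (v zero) (y zero) u (tail d ∙ tail y) (tail v ∙ tail y))

  ᵀ-adjoint : ∀ {m n} (B : Matrix m n) x y → x ∙ (B ᵀ ⊛ y) ≈ (B ⊛ x) ∙ y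
  ᵀ-adjoint B x y = begin
    sum (λ i → x i * sum (λ k → B k i * y k))
      ≈⟨ sum-cong-≋ (λ i → *-distribˡ-sum (x i) (λ k → B k i * y k)) ⟩
    sum (λ i → sum (λ k → x i * (B k i * y k)))
      ≈⟨ ∑-comm (λ i k → x i * (B k i * y k)) ⟩
    sum (λ k → sum (λ i → x i * (B k i * y k)))
      ≈⟨ sum-cong-≋ (λ k → sum-cong-≋ (λ i →
           solve 3 (λ a b c → (a :* (b :* c)) := ((b :* a) :* c)) refl (x i) (B k i) (y k))) ⟩
    sum (λ k → sum (λ i → (B k i * x i) * y k))
      ≈⟨ sum-cong-≋ (λ k → sym (*-distribʳ-sum (y k) (λ i → B k i * x i))) ⟩
    sum (λ k → sum (λ i → B k i * x i) * y k) ∎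

  ⊡-⊛-assoc : ∀ {l m n} (M : Matrix l m) (N : Matrix m n) x →
              (M ⊡ N) ⊛ x ≋ M ⊛ (N ⊛ x)
  ⊡-⊛-assoc M N x i = begin
    (M ⊡ N) i ∙ x          ≈⟨ ∙-cong (λ j → ∙-comm (M i) ((N ᵀ) j)) (λ _ → refl) ⟩
    (N ᵀ ⊛ M i) ∙ x        ≈⟨ sym (ᵀ-adjoint (N ᵀ) (M i) x) ⟩
    M i ∙ (N ⊛ x)          ∎

  quad-gram : ∀ {m n} (B : Matrix m n) x → quad (gram B) x ≈ (B ⊛ x) ∙ (B ⊛ x)
  quad-gram B x = trans (∙-cong {x = x} (λ _ → refl) (⊡-⊛-assoc (B ᵀ) B x))
                        (ᵀ-adjoint B x (B ⊛ x))

  x≤0⇒0≤-x : ∀ {x} → x ≤ 0# → 0# ≤ - x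
  x≤0⇒0≤-x {x} p =
    ≤-trans (≤-reflexive (sym (-‿inverseʳ x)))
            (≤-trans (+-monoˡ-≤ (- x) p) (≤-reflexive (+-identityˡ (- x))))

  -x*y≈x*-y : ∀ x y → - x * y ≈ x * - y
  -x*y≈x*-y x y = trans (sym (-‿distribˡ-* x y)) (-‿distribʳ-* x y)

  square-nonneg : ∀ x → 0# ≤ x * x
  square-nonneg x with total 0# x
  ... | inj₁ 0≤x = *-nonneg 0≤x 0≤x
  ... | inj₂ x≤0 = ≤-trans (*-nonneg (x≤0⇒0≤-x x≤0) (x≤0⇒0≤-x x≤0))
    (≤-reflexive (trans (-x*y≈x*-y x (- x)) (*-congˡ (-‿involutive x))))

  x≤x+y : ∀ {x y} → 0# ≤ y → x ≤ x + y
  x≤x+y {x} {y} 0≤y = ≤-trans (≤-reflexive (sym (+-identityˡ x)))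
    (≤-trans (+-monoˡ-≤ x 0≤y) (≤-reflexive (+-comm y x)))

  ∙-self-nonneg : ∀ {n} (x : ℝ^ n) → 0# ≤ x ∙ x
  ∙-self-nonneg {zero}  x = ≤-refl
  ∙-self-nonneg {suc n} x =
    ≤-trans (square-nonneg (head x)) (x≤x+y (∙-self-nonneg (tail x)))

  integral : ∀ {x y} → ¬ (x ≈ 0#) → x * y ≈ 0# → y ≈ 0#
  integral {x} {y} x≉0 xy≈0 = begin
    y                ≈⟨ sym (*-identityˡ y) ⟩
    1# * y           ≈⟨ *-congʳ (sym (*-inverseʳ x≉0)) ⟩
    (x * x ⁻¹) * y   ≈⟨ solve 3 (λ a b c → ((a :* b) :* c) := (b :* (a :* c))) refl x (x ⁻¹) y ⟩
    x ⁻¹ * (x * y)   ≈⟨ *-congˡ xy≈0 ⟩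
    x ⁻¹ * 0#        ≈⟨ zeroʳ (x ⁻¹) ⟩
    0#               ∎

  square-zero : ∀ {x} → x * x ≈ 0# → x ≈ 0#
  square-zero {x} xx≈0 with x ≈? 0#
  ... | yes x≈0 = x≈0
  ... | no  x≉0 = integral x≉0 xx≈0

  ∙-self-zero : ∀ {n} (x : ℝ^ n) → x ∙ x ≈ 0# → x ≋ 𝟎
  ∙-self-zero {suc n} x xx≈0 = λ where
      zero    → square-zero head-zero
      (suc i) → ∙-self-zero (tail x) tail-zero i
    where
    head-zero : head x * head x ≈ 0#
    head-zero = ≤-antisym
      (≤-trans (x≤x+y (∙-self-nonneg (tail x))) (≤-reflexive xx≈0))
      (square-nonneg (head x))
    tail-zero : tail x ∙ tail x ≈ 0#
    tail-zero = trans (sym (+-identityˡ _)) (trans (+-congʳ (sym head-zero)) xx≈0)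

  Anisotropic : ∀ {n} → Matrix n n → Set
  Anisotropic M = ∀ x → quad M x ≈ 0# → x ≋ 𝟎

  gram-anisotropic : ∀ {m n} (B : Matrix m n) → FullColumnRank B → Anisotropic (gram B)
  gram-anisotropic B fcr x q≈0 =
    fcr x (∙-self-zero (B ⊛ x) (trans (sym (quad-gram B x)) q≈0))

  pivot : ∀ {n} → Matrix (suc n) (suc n) → Carrier
  pivot M = M zero zero

  schur : ∀ {n} → Matrix (suc n) (suc n) → Matrix n n
  schur M i j = M (suc i) (suc j) + - (M (suc i) zero * pivot M ⁻¹) * M zero (suc j)

  backSubstitute : ∀ {n} → Matrix (suc n) (suc n) → Carrier → ℝ^ n → ℝ^ (suc n)
  backSubstitute M c y = (pivot M ⁻¹ * (c + - (tail (M zero) ∙ y))) ∷ y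

  pivot-nonzero : ∀ {n} (M : Matrix (suc n) (suc n)) → Anisotropic M → ¬ (pivot M ≈ 0#)
  pivot-nonzero M an a≈0 = 0≉1 (sym (an e₀ quad-zero zero))
    where
    e₀ = 1# ∷ 𝟎
    quad-zero : quad M e₀ ≈ 0#
    quad-zero = begin
      1# * (M zero zero * 1# + tail (M zero) ∙ 𝟎) + 𝟎 ∙ tail (M ⊛ e₀)
        ≈⟨ +-cong (*-congˡ (+-cong (*-congʳ a≈0) (∙-zeroʳ (tail (M zero)))))
                  (∙-zeroˡ (tail (M ⊛ e₀))) ⟩
      1# * (0# * 1# + 0#) + 0#
        ≈⟨ trans (+-identityʳ _) (trans (*-identityˡ _) (trans (+-identityʳ _) (zeroˡ 1#))) ⟩
      0# ∎

  elimination-head : ∀ {n} (M : Matrix (suc n) (suc n)) → ¬ (pivot M ≈ 0#) →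
                     ∀ c y → (M ⊛ backSubstitute M c y) zero ≈ c
  elimination-head M a≉0 c y = begin
    a * (a ⁻¹ * (c + - r)) + r   ≈⟨ +-congʳ (sym (*-assoc a (a ⁻¹) _)) ⟩
    (a * a ⁻¹) * (c + - r) + r   ≈⟨ +-congʳ (trans (*-congʳ (*-inverseʳ a≉0)) (*-identityˡ _)) ⟩
    (c + - r) + r                ≈⟨ +-assoc c (- r) r ⟩
    c + (- r + r)                ≈⟨ +-congˡ (-‿inverseˡ r) ⟩
    c + 0#                       ≈⟨ +-identityʳ c ⟩
    c                            ∎
    where
    a = pivot M
    r = tail (M zero) ∙ y

  elimination-tail : ∀ {n} (M : Matrix (suc n) (suc n)) c y i →
    (M ⊛ backSubstitute M c y) (suc i) ≈
    M (suc i) zero * pivot M ⁻¹ * c + (schur M ⊛ y) i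
  elimination-tail M c y i = begin
    b * (a⁻¹ * (c + - r)) + d
      ≈⟨ solve 5 (λ b a c r d → b :* (a :* (c :+ r)) :+ d := b :* a :* c :+ (d :+ b :* a :* r))
           refl b a⁻¹ c (- r) d ⟩
    b * a⁻¹ * c + (d + b * a⁻¹ * - r)
      ≈⟨ +-congˡ (+-congˡ (sym (-x*y≈x*-y (b * a⁻¹) r))) ⟩
    b * a⁻¹ * c + (d + - (b * a⁻¹) * r)
      ≈⟨ +-congˡ (sym (∙-linearˡ (tail (M (suc i))) (tail (M zero)) y (- (b * a⁻¹)))) ⟩
    b * a⁻¹ * c + (schur M ⊛ y) i ∎
    where
    b   = M (suc i) zero
    a⁻¹ = pivot M ⁻¹
    r   = tail (M zero) ∙ y
    d   = tail (M (suc i)) ∙ y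

  schur-anisotropic : ∀ {n} (M : Matrix (suc n) (suc n)) → Anisotropic M → Anisotropic (schur M)
  schur-anisotropic M an y q≈0 i = an x quad-zero (suc i)
    where
    x = backSubstitute M 0# y
    quad-zero : quad M x ≈ 0#
    quad-zero = begin
      head x * (M ⊛ x) zero + y ∙ tail (M ⊛ x)
        ≈⟨ +-cong (*-congˡ (elimination-head M (pivot-nonzero M an) 0# y))
                  (∙-cong {x = y} (λ _ → refl) (λ i →
                     trans (elimination-tail M 0# y i)
                           (trans (+-congʳ (zeroʳ _)) (+-identityˡ _)))) ⟩
      head x * 0# + quad (schur M) y   ≈⟨ +-cong (zeroʳ (head x)) q≈0 ⟩
      0# + 0#                          ≈⟨ +-identityˡ 0# ⟩
      0#                               ∎

  solvable : ∀ {n} (M : Matrix n n) → Anisotropic M → ∀ y → ∃ λ x → M ⊛ x ≋ y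
  solvable {zero}  M an y = y , λ ()
  solvable {suc n} M an y = x , λ where
      zero    → elimination-head M (pivot-nonzero M an) (head y) x′
      (suc i) → trans (elimination-tail M (head y) x′ i)
                      (trans (+-congˡ (proj₂ rest i)) (cancel (k i) (y (suc i))))
    where
    k : ℝ^ n
    k i = M (suc i) zero * pivot M ⁻¹ * head y
    rest = solvable (schur M) (schur-anisotropic M an) (λ i → y (suc i) + - k i)
    x′ = proj₁ rest
    x  = backSubstitute M (head y) x′
    cancel : ∀ u v → u + (v + - u) ≈ v
    cancel u v = begin
      u + (v + - u)   ≈⟨ +-congˡ (+-comm v (- u)) ⟩
      u + (- u + v)   ≈⟨ sym (+-assoc u (- u) v) ⟩
      (u + - u) + v   ≈⟨ +-congʳ (-‿inverseʳ u) ⟩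
      0# + v          ≈⟨ +-identityˡ v ⟩
      v               ∎

  Diag-∙ : ∀ {n} (v x : ℝ^ n) i → Diag v i ∙ x ≈ v i * x i
  Diag-∙ v x zero =
    trans (+-congˡ (∙-zeroˡ (tail x))) (+-identityʳ _)
  Diag-∙ v x (suc i) =
    trans (+-cong (zeroˡ (head x)) (Diag-∙ (tail v) (tail x) i)) (+-identityˡ _)

  anisotropic-injective : ∀ {n} (M : Matrix n n) → Anisotropic M →
                          ∀ x y → M ⊛ x ≋ M ⊛ y → x ≋ y
  anisotropic-injective M an x y Mx≋My i = z≈0⇒x≈y (an z quad-zero i)
    where
    z : ℝ^ _
    z j = x j + - 1# * y j
    Mz≋𝟎 : M ⊛ z ≋ 𝟎
    Mz≋𝟎 k = begin
      M k ∙ z                     ≈⟨ ∙-comm (M k) z ⟩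
      z ∙ M k                     ≈⟨ ∙-linearˡ x y (M k) (- 1#) ⟩
      x ∙ M k + - 1# * (y ∙ M k)  ≈⟨ +-cong (∙-comm x (M k)) (-1*x≈-x _) ⟩
      M k ∙ x + - (y ∙ M k)       ≈⟨ +-cong (Mx≋My k) (-‿cong (∙-comm y (M k))) ⟩
      M k ∙ y + - (M k ∙ y)       ≈⟨ -‿inverseʳ _ ⟩
      0#                          ∎
    quad-zero : quad M z ≈ 0#
    quad-zero = trans (∙-cong {x = z} (λ _ → refl) Mz≋𝟎) (∙-zeroʳ z)
    z≈0⇒x≈y : x i + - 1# * y i ≈ 0# → x i ≈ y i
    z≈0⇒x≈y p = x-y≈0⇒x≈y (x i) (y i) (trans (+-congˡ (sym (-1*x≈-x (y i)))) p)

  Id-sym : ∀ {n} (i j : Fin n) → Id i j ≈ Id j i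
  Id-sym zero    zero    = refl
  Id-sym zero    (suc j) = refl
  Id-sym (suc i) zero    = refl
  Id-sym (suc i) (suc j) = Id-sym i j

  anisotropic-invertible : ∀ {n} (M : Matrix n n) → Anisotropic M → Invertible M
  anisotropic-invertible {n} M an = N , NM≋Id , MN≋Id
    where
    column : ∀ j → ∃ λ x → M ⊛ x ≋ (Id ᵀ) j
    column j = solvable M an ((Id ᵀ) j)
    N : Matrix n n
    N i j = proj₁ (column j) i
    MN≋Id : M ⊡ N ≋ₘ Id
    MN≋Id i j = proj₂ (column j) i
    NM≋Id : N ⊡ M ≋ₘ Id
    NM≋Id i j = anisotropic-injective M an (λ k → (N ⊡ M) k j) (λ k → Id k j) same i
      where
      same : M ⊛ (λ k → (N ⊡ M) k j) ≋ M ⊛ (λ k → Id k j)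
      same k = begin
        M k ∙ (N ⊛ (M ᵀ) j)          ≈⟨ sym (⊡-⊛-assoc M N ((M ᵀ) j) k) ⟩
        (M ⊡ N) k ∙ (M ᵀ) j          ≈⟨ ∙-cong (MN≋Id k) (λ _ → refl) ⟩
        Id k ∙ (M ᵀ) j               ≈⟨ Diag-∙ (λ _ → 1#) ((M ᵀ) j) k ⟩
        1# * M k j                   ≈⟨ sym (Diag-∙ (λ _ → 1#) (M k) j) ⟩
        Id j ∙ M k                   ≈⟨ ∙-cong (λ l → Id-sym j l) (λ _ → refl) ⟩
        (λ l → Id l j) ∙ M k         ≈⟨ ∙-comm _ (M k) ⟩
        M k ∙ (λ l → Id l j)         ∎

  gram-invertible : ∀ {m n} (B : Matrix m n) → NonDegenerate B → Invertible (gram B)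
  gram-invertible B nd = anisotropic-invertible (gram B) (gram-anisotropic B (proj₁ nd))

  Positive : ∀ {n} → ℝ^ n → Set
  Positive v = ∀ i → 0# < v i

  Diag-nonDegenerate : ∀ {m n} {v : ℝ^ m} → Positive v → {A : Matrix m n} →
                       NonDegenerate A → NonDegenerate (Diag v ⊡ A)
  Diag-nonDegenerate {v = v} v>0 {A} (fcr , nz) =
      (λ x p → fcr x λ i → integral (v≉0 i)
         (trans (sym (Diag-∙ v (A ⊛ x) i)) (trans (sym (⊡-⊛-assoc (Diag v) A x i)) (p i))))
    , (λ i p → nz i λ j → integral (v≉0 i)
         (trans (sym (Diag-∙ v ((A ᵀ) j) i)) (p j)))
    where
    v≉0 : ∀ i → ¬ (v i ≈ 0#)
    v≉0 i vi≈0 = proj₂ (v>0 i) (sym vi≈0)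

  σ : ∀ {m n} (B : Matrix m n) → NonDegenerate B → ℝ^ m
  σ B nd = diag (B ⊡ gram⁻¹ ⊡ B ᵀ)
    where gram⁻¹ = proj₁ (gram-invertible B nd)

  _^ᵛ_ : ∀ {m} → ℝ^ m → Carrier → ℝ^ m
  (w ^ᵛ a) i = w i ^ a

  σ-scaled : ∀ {m n} (w : ℝ^ m) → Positive w → Carrier →
             (A : Matrix m n) → NonDegenerate A → ℝ^ m
  σ-scaled w w>0 a A nd =
    σ (Diag (w ^ᵛ a) ⊡ A) (Diag-nonDegenerate (λ i → ^-pos a (w>0 i)) nd)

  record IsLewisWeight {m n} (p : Carrier) (A : Matrix m n) (nd : NonDegenerate A)
                       (w : ℝ^ m) : Set where
    field
      positive   : Positive w
      fixedPoint : w ≋ σ-scaled w positive (½ + - (p ⁻¹)) A nd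

  -- c_{p,∞,m}, with α = 2/p
  lewisConstant : Carrier → ℕ → Carrier
  lewisConstant p m =
    (1# + α) ^ ((1# + α) ⁻¹) * ((1# + α ⁻¹) * fromℕ m) ^ (α * (1# + α) ⁻¹)
    where α = 2# * p ⁻¹

  infixr 8 _•_

  _•_ : ∀ {n} → Carrier → Pred (ℝ^ n) 0ℓ → Pred (ℝ^ n) 0ℓ
  (c • S) x = ∃ λ y → S y × (x ≋ λ i → c * y i)

  -- Centred at the origin, which is also the centre of scaling.
  IsEllipsoid : ∀ {n} → Pred (ℝ^ n) 0ℓ → Set
  IsEllipsoid F = ∃ λ Q → PositiveDefinite Q × (F ≐ λ x → quad Q x ≤ 1#)

  record IsRounding {n} (F K : Pred (ℝ^ n) 0ℓ) (ν : Carrier) : Set where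
    field
      ellipsoid : IsEllipsoid F
      inner     : F ⊆ K
      outer     : K ⊆ ν • F

  lewisEllipsoid : ∀ {m n} → Matrix m n → ℝ^ m → Pred (ℝ^ n) 0ℓ
  lewisEllipsoid A w x = quad (A ᵀ ⊡ Diag w ⊡ A) x ≤ 1#

  -- Rows are indexed by Fin (suc m): the maximum of an empty vector is undefined.
  ∞-ball : ∀ {m n} → Matrix (suc m) n → Pred (ℝ^ n) 0ℓ
  ∞-ball A x = ∥ A ⊛ x ∥∞ ≤ 1#

module Submission where

-- Write y i = (aᵢ · x)² for the rows aᵢ of A, and s for the leverage scores of a rescaling
-- of A with squared row factors b.  Cauchy–Schwarz against the columns of the orthogonal
-- projection onto its range gives b i * y i ≤ s i * (b ∙ y), with equality for some x, and
-- the trace of the projection gives ∑ s = n.  For b = w this makes max (s i / w i) the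
-- least r.  For the Lewis exponent s = w, so ∑ w = n, which gives K ⊆ √n E.
--
-- For the inner inclusion put q = b ∙ y, T = (1 + 1/α) m and C = c_{p,∞,m}.  Since
-- b i * w i ^ α = w i, each i satisfies b i * y i ≤ T ^ α * (w i * y i) + q / T; summing
-- gives q ≤ C ^ (1 + α) * (w ∙ y).  Then y i ≤ C * (w ∙ y), either because C * w i ≥ 1 or
-- because y i ≤ w i ^ α * q.

open import Defs
open import Data.Nat.Base using (ℕ; zero; suc)
open import Data.Fin.Base using (Fin; zero; suc)
open import Data.Product.Base using (_×_; _,_; proj₁; proj₂; ∃)
open import Data.Sum.Base using (inj₁; inj₂)
open import Relation.Nullary using (¬_; yes; no; contradiction)
open import Relation.Unary using (Pred; _⊆_)
open import Relation.Binary.Bundles using (TotalOrder)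
open import Relation.Binary.PropositionalEquality as ≡ using (_≡_)
import Relation.Binary.Reasoning.PartialOrder as PosetReasoning
import Algebra.Construct.NaturalChoice.Max as Max
import Algebra.Properties.AbelianGroup as AbelianGroupProperties
import Algebra.Properties.Ring as RingProperties
import Algebra.Properties.Semiring.Sum as SemiringSum
import Algebra.Solver.Ring.NaturalCoefficients.Default as SemiringSolver

-- Order and inverses in the reals.

module RealProperties (ℝ : RealNumbers) where
  open RealNumbers ℝ hiding (zero)
  open Matrices ℝ
  open Max totalOrder using (x≤x⊔y; x≤y⊔x; ⊔-lub)
  open AbelianGroupProperties +-abelianGroup using (xyx⁻¹≈y)
  open RingProperties ring using (-‿involutive)
  open SemiringSum semiring using (sum)
  open PosetReasoning (TotalOrder.poset totalOrder)

  x≤y⇒0≤y-x : ∀ {x y} → x ≤ y → 0# ≤ y - x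
  x≤y⇒0≤y-x {x} {y} x≤y = begin
    0#     ≈⟨ -‿inverseʳ x ⟨
    x - x  ≤⟨ +-monoˡ-≤ (- x) x≤y ⟩
    y - x  ∎

  +-monoʳ-≤ : ∀ {x y} z → x ≤ y → z + x ≤ z + y
  +-monoʳ-≤ {x} {y} z x≤y = begin
    z + x  ≈⟨ +-comm z x ⟩
    x + z  ≤⟨ +-monoˡ-≤ z x≤y ⟩
    y + z  ≈⟨ +-comm y z ⟩
    z + y  ∎

  +-mono-≤ : ∀ {x y u v} → x ≤ y → u ≤ v → x + u ≤ y + v
  +-mono-≤ x≤y u≤v = ≤-trans (+-monoˡ-≤ _ x≤y) (+-monoʳ-≤ _ u≤v)

  +-nonneg : ∀ {x y} → 0# ≤ x → 0# ≤ y → 0# ≤ x + y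
  +-nonneg 0≤x 0≤y = ≤-trans 0≤x (x≤x+y 0≤y)

  +-cancelˡ-≤ : ∀ {x y} z → z + x ≤ z + y → x ≤ y
  +-cancelˡ-≤ {x} {y} z p = begin
    x          ≈⟨ xyx⁻¹≈y z x ⟨
    z + x - z  ≤⟨ +-monoˡ-≤ (- z) p ⟩
    z + y - z  ≈⟨ xyx⁻¹≈y z y ⟩
    y          ∎

  *-monoʳ-≤ : ∀ {x y z} → 0# ≤ z → x ≤ y → z * x ≤ z * y
  *-monoʳ-≤ {x} {y} {z} 0≤z x≤y = begin
    z * x                ≤⟨ x≤x+y (*-nonneg 0≤z (x≤y⇒0≤y-x x≤y)) ⟩
    z * x + z * (y - x)  ≈⟨ distribˡ z x (y - x) ⟨
    z * (x + (y - x))    ≈⟨ *-congˡ (trans (sym (+-assoc x y (- x))) (xyx⁻¹≈y x y)) ⟩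
    z * y                ∎

  *-monoˡ-≤ : ∀ {x y z} → 0# ≤ z → x ≤ y → x * z ≤ y * z
  *-monoˡ-≤ {x} {y} {z} 0≤z x≤y = begin
    x * z  ≈⟨ *-comm x z ⟩
    z * x  ≤⟨ *-monoʳ-≤ 0≤z x≤y ⟩
    z * y  ≈⟨ *-comm z y ⟩
    y * z  ∎

  1≤y⇒x≤y*x : ∀ {x y} → 0# ≤ x → 1# ≤ y → x ≤ y * x
  1≤y⇒x≤y*x {x} 0≤x 1≤y = ≤-respˡ-≈ (*-identityˡ x) (*-monoˡ-≤ 0≤x 1≤y)

  y≤1⇒y*x≤x : ∀ {x y} → 0# ≤ x → y ≤ 1# → y * x ≤ x
  y≤1⇒y*x≤x {x} 0≤x y≤1 = ≤-respʳ-≈ (*-identityˡ x) (*-monoˡ-≤ 0≤x y≤1)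

  pos⇒≉0 : ∀ {x} → 0# < x → ¬ (x ≈ 0#)
  pos⇒≉0 (_ , 0≉x) x≈0 = 0≉x (sym x≈0)

  0<1 : 0# < 1#
  0<1 = ≤-respʳ-≈ (*-identityˡ 1#) (square-nonneg 1#) , 0≉1

  pos-resp-≈ : ∀ {x y} → x ≈ y → 0# < x → 0# < y
  pos-resp-≈ x≈y (0≤x , 0≉x) = ≤-respʳ-≈ x≈y 0≤x , λ 0≈y → 0≉x (trans 0≈y (sym x≈y))

  pos-≤ : ∀ {x y} → 0# < x → x ≤ y → 0# < y
  pos-≤ {x} {y} 0<x x≤y = begin-strict
    0#  <⟨ 0<x ⟩
    x   ≤⟨ x≤y ⟩
    y   ∎

  +-pos : ∀ {x y} → 0# < x → 0# ≤ y → 0# < x + y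
  +-pos 0<x 0≤y = pos-≤ 0<x (x≤x+y 0≤y)

  *-pos : ∀ {x y} → 0# < x → 0# < y → 0# < x * y
  *-pos 0<x 0<y =
    *-nonneg (proj₁ 0<x) (proj₁ 0<y) ,
    λ 0≈xy → pos⇒≉0 0<y (integral (pos⇒≉0 0<x) (sym 0≈xy))

  *-inverseˡ : ∀ {x} → ¬ (x ≈ 0#) → x ⁻¹ * x ≈ 1#
  *-inverseˡ {x} x≉0 = trans (*-comm (x ⁻¹) x) (*-inverseʳ x≉0)

  ⁻¹-pos : ∀ {x} → 0# < x → 0# < x ⁻¹
  ⁻¹-pos {x} 0<x = nonneg , nonzero
    where
    nonneg : 0# ≤ x ⁻¹
    -- The inverse equals `x` times the square of the inverse, a product of nonnegative factors.
    nonneg = begin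
      0#                 ≤⟨ *-nonneg (proj₁ 0<x) (square-nonneg (x ⁻¹)) ⟩
      x * (x ⁻¹ * x ⁻¹)  ≈⟨ *-assoc x (x ⁻¹) (x ⁻¹) ⟨
      x * x ⁻¹ * x ⁻¹    ≈⟨ *-congʳ (*-inverseʳ (pos⇒≉0 0<x)) ⟩
      1# * x ⁻¹          ≈⟨ *-identityˡ (x ⁻¹) ⟩
      x ⁻¹               ∎
    nonzero : ¬ (0# ≈ x ⁻¹)
    nonzero 0≈x⁻¹ = 0≉1 (begin-equality
      0#        ≈⟨ zeroʳ x ⟨
      x * 0#    ≈⟨ *-congˡ 0≈x⁻¹ ⟩
      x * x ⁻¹  ≈⟨ *-inverseʳ (pos⇒≉0 0<x) ⟩
      1#        ∎)

  x⁻¹*[x*y]≈y : ∀ {x} → 0# < x → ∀ y → x ⁻¹ * (x * y) ≈ y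
  x⁻¹*[x*y]≈y {x} 0<x y = begin-equality
    x ⁻¹ * (x * y)  ≈⟨ *-assoc (x ⁻¹) x y ⟨
    x ⁻¹ * x * y    ≈⟨ *-congʳ (*-inverseˡ (pos⇒≉0 0<x)) ⟩
    1# * y          ≈⟨ *-identityˡ y ⟩
    y               ∎

  *-cancelˡ-≤ : ∀ {x y z} → 0# < z → z * x ≤ z * y → x ≤ y
  *-cancelˡ-≤ {x} {y} {z} 0<z p = begin
    x               ≈⟨ x⁻¹*[x*y]≈y 0<z x ⟨
    z ⁻¹ * (z * x)  ≤⟨ *-monoʳ-≤ (proj₁ (⁻¹-pos 0<z)) p ⟩
    z ⁻¹ * (z * y)  ≈⟨ x⁻¹*[x*y]≈y 0<z y ⟩
    y               ∎

  *-cancelˡ : ∀ {x y z} → 0# < z → z * x ≈ z * y → x ≈ y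
  *-cancelˡ {x} {y} {z} 0<z p =
    trans (sym (x⁻¹*[x*y]≈y 0<z x)) (trans (*-congˡ p) (x⁻¹*[x*y]≈y 0<z y))

  2#-pos : 0# < 2#
  2#-pos = +-pos 0<1 (proj₁ 0<1)

  ½-pos : 0# < ½
  ½-pos = ⁻¹-pos 2#-pos

  ½+½≈1 : ½ + ½ ≈ 1#
  ½+½≈1 = begin-equality
    ½ + ½            ≈⟨ +-cong (sym (*-identityˡ ½)) (sym (*-identityˡ ½)) ⟩
    1# * ½ + 1# * ½  ≈⟨ distribʳ ½ 1# 1# ⟨
    2# * ½           ≈⟨ *-inverseʳ (pos⇒≉0 2#-pos) ⟩
    1#               ∎

  fromℕ-nonneg : ∀ k → 0# ≤ fromℕ k
  fromℕ-nonneg zero    = ≤-refl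
  fromℕ-nonneg (suc k) = +-nonneg (proj₁ 0<1) (fromℕ-nonneg k)

  fromℕ-pos : ∀ k → 0# < fromℕ (suc k)
  fromℕ-pos k = +-pos 0<1 (fromℕ-nonneg k)

  -- Real powers and square roots.

  idempotent⇒≈1 : ∀ {x} → 0# < x → x * x ≈ x → x ≈ 1#
  idempotent⇒≈1 0<x xx≈x = *-cancelˡ 0<x (trans xx≈x (sym (*-identityʳ _)))

  -- By additivity in the exponent, `x ^ 0#` is equal to its own square, and it is positive.
  ^-zero : ∀ {x} → 0# < x → x ^ 0# ≈ 1#
  ^-zero 0<x = idempotent⇒≈1 (^-pos 0# 0<x)
    (trans (sym (^-+ 0# 0# 0<x)) (^-cong refl (+-identityˡ 0#)))

  1^a≈1 : ∀ a → 1# ^ a ≈ 1#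
  1^a≈1 a = idempotent⇒≈1 (^-pos a 0<1)
    (trans (sym (^-distrib a 0<1 0<1)) (^-cong (*-identityˡ 1#) refl))

  1≤x⇒1≤x^a : ∀ {x a} → 0# ≤ a → 1# ≤ x → 1# ≤ x ^ a
  1≤x⇒1≤x^a 0≤a 1≤x = ≤-respˡ-≈ (^-zero (pos-≤ 0<1 1≤x)) (^-monoʳ-≤ 1≤x 0≤a)

  -- Monotonicity in the exponent is given for bases at least 1, so it is applied to `x ⁻¹`, whose
  -- power multiplies `x ^ a` to 1.
  x≤1⇒x^a≤1 : ∀ {x a} → 0# ≤ a → 0# < x → x ≤ 1# → x ^ a ≤ 1#
  x≤1⇒x^a≤1 {x} {a} 0≤a 0<x x≤1 = begin
    x ^ a             ≤⟨ 1≤y⇒x≤y*x (proj₁ (^-pos a 0<x)) (1≤x⇒1≤x^a 0≤a 1≤x⁻¹) ⟩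
    (x ⁻¹) ^ a * x ^ a  ≈⟨ ^-distrib a (⁻¹-pos 0<x) 0<x ⟨
    (x ⁻¹ * x) ^ a    ≈⟨ ^-cong (*-inverseˡ (pos⇒≉0 0<x)) refl ⟩
    1# ^ a            ≈⟨ 1^a≈1 a ⟩
    1#                ∎
    where
    1≤x⁻¹ : 1# ≤ x ⁻¹
    1≤x⁻¹ = *-cancelˡ-≤ 0<x (begin
      x * 1#    ≈⟨ *-identityʳ x ⟩
      x         ≤⟨ x≤1 ⟩
      1#        ≈⟨ *-inverseʳ (pos⇒≉0 0<x) ⟨
      x * x ⁻¹  ∎)

  ^-inverseʳ : ∀ {x} a → 0# < x → x ^ a * x ^ (- a) ≈ 1#
  ^-inverseʳ {x} a 0<x = begin-equality
    x ^ a * x ^ (- a)  ≈⟨ ^-+ a (- a) 0<x ⟨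
    x ^ (a - a)        ≈⟨ ^-cong refl (-‿inverseʳ a) ⟩
    x ^ 0#             ≈⟨ ^-zero 0<x ⟩
    1#                 ∎

  -- The exponent laws hold for positive bases; at 0 the value comes from `0^`.
  √-square : ∀ {x} → 0# ≤ x → √ x * √ x ≈ x
  √-square {x} 0≤x with x ≈? 0#
  ... | yes x≈0 = begin-equality
    √ x * √ x    ≈⟨ *-congˡ (trans (^-cong x≈0 refl) (0^ ½-pos)) ⟩
    √ x * 0#     ≈⟨ zeroʳ (√ x) ⟩
    0#           ≈⟨ x≈0 ⟨
    x            ∎
  ... | no x≉0 = begin-equality
    √ x * √ x    ≈⟨ ^-+ ½ ½ 0<x ⟨
    x ^ (½ + ½)  ≈⟨ ^-cong refl ½+½≈1 ⟩
    x ^ 1#       ≈⟨ ^-one 0<x ⟩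
    x            ∎
    where
    0<x : 0# < x
    0<x = 0≤x , λ 0≈x → x≉0 (sym 0≈x)

  -- Absolute values, maxima and finite sums.

  -x*-x≈x*x : ∀ x → - x * - x ≈ x * x
  -x*-x≈x*x x = trans (-x*y≈x*-y x (- x)) (*-congˡ (-‿involutive x))

  x*x≤1⇒x≤1 : ∀ {x} → x * x ≤ 1# → x ≤ 1#
  x*x≤1⇒x≤1 {x} xx≤1 with total x 1#
  ... | inj₁ x≤1 = x≤1
  ... | inj₂ 1≤x = ≤-trans (1≤y⇒x≤y*x (≤-trans (proj₁ 0<1) 1≤x) 1≤x) xx≤1

  x*x≤1⇒∣x∣≤1 : ∀ {x} → x * x ≤ 1# → ∣ x ∣ ≤ 1#
  x*x≤1⇒∣x∣≤1 {x} xx≤1 =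
    ⊔-lub (x*x≤1⇒x≤1 xx≤1) (x*x≤1⇒x≤1 (≤-respˡ-≈ (sym (-x*-x≈x*x x)) xx≤1))

  ∣x∣≤1⇒x*x≤1 : ∀ {x} → ∣ x ∣ ≤ 1# → x * x ≤ 1#
  ∣x∣≤1⇒x*x≤1 {x} ∣x∣≤1 with total 0# x
  ... | inj₁ 0≤x = ≤-trans (y≤1⇒y*x≤x 0≤x x≤1) x≤1
    where
    x≤1 : x ≤ 1#
    x≤1 = ≤-trans (x≤x⊔y x (- x)) ∣x∣≤1
  ... | inj₂ x≤0 =
    ≤-respˡ-≈ (-x*-x≈x*x x) (≤-trans (y≤1⇒y*x≤x (x≤0⇒0≤-x x≤0) -x≤1) -x≤1)
    where
    -x≤1 : - x ≤ 1#
    -x≤1 = ≤-trans (x≤y⊔x x (- x)) ∣x∣≤1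

  x≤max : ∀ {k} (x : ℝ^ (suc k)) i → x i ≤ max x
  x≤max {zero}  x zero    = ≤-refl
  x≤max {suc k} x zero    = x≤x⊔y _ _
  x≤max {suc k} x (suc i) = ≤-trans (x≤max (λ j → x (suc j)) i) (x≤y⊔x _ _)

  max-lub : ∀ {k} (x : ℝ^ (suc k)) {u} → (∀ i → x i ≤ u) → max x ≤ u
  max-lub {zero}  x x≤u = x≤u zero
  max-lub {suc k} x x≤u = ⊔-lub (x≤u zero) (max-lub (λ j → x (suc j)) (λ i → x≤u (suc i)))

  sum-mono-≤ : ∀ {k} {f g : ℝ^ k} → (∀ i → f i ≤ g i) → sum f ≤ sum g
  sum-mono-≤ {zero}  f≤g = ≤-refl
  sum-mono-≤ {suc k} f≤g = +-mono-≤ (f≤g zero) (sum-mono-≤ (λ i → f≤g (suc i)))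

  sum-nonneg : ∀ {k} {f : ℝ^ k} → (∀ i → 0# ≤ f i) → 0# ≤ sum f
  sum-nonneg {zero}  0≤f = ≤-refl
  sum-nonneg {suc k} 0≤f = +-nonneg (0≤f zero) (sum-nonneg (λ i → 0≤f (suc i)))

  term≤sum : ∀ {k} {f : ℝ^ k} → (∀ i → 0# ≤ f i) → ∀ i → f i ≤ sum f
  term≤sum 0≤f zero    = x≤x+y (sum-nonneg (λ i → 0≤f (suc i)))
  term≤sum {f = f} 0≤f (suc i) = begin
    f (suc i)                        ≤⟨ term≤sum (λ j → 0≤f (suc j)) i ⟩
    sum (λ j → f (suc j))            ≤⟨ x≤x+y (0≤f zero) ⟩
    sum (λ j → f (suc j)) + f zero   ≈⟨ +-comm _ (f zero) ⟩
    sum f                            ∎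

-- Leverage scores through the orthogonal projection onto the range.

module LeverageScores (ℝ : RealNumbers) where
  open RealNumbers ℝ hiding (zero; total)
  open Matrices ℝ
  open RealProperties ℝ
  open SemiringSum semiring
    using (sum; sum-cong-≋; sum-replicate; ∑-comm; *-distribˡ-sum; *-distribʳ-sum)
  open SemiringSolver commutativeSemiring using (solve; _:+_; _:*_; _:=_)
  open PosetReasoning (TotalOrder.poset totalOrder)

  ∙-scaleʳ : ∀ {n} (a x : ℝ^ n) c → a ∙ (λ j → c * x j) ≈ c * (a ∙ x)
  ∙-scaleʳ a x c = trans
    (sum-cong-≋ (λ j → solve 3 (λ a c x → a :* (c :* x) := c :* (a :* x)) refl (a j) c (x j)))
    (sym (*-distribˡ-sum c (λ j → a j * x j)))

  sum-const : ∀ k c → sum {k} (λ _ → c) ≈ fromℕ k * c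
  sum-const k c = begin-equality
    sum {k} (λ _ → c)       ≈⟨ sum-cong-≋ {k} (λ _ → sym (*-identityˡ c)) ⟩
    sum {k} (λ _ → 1# * c)  ≈⟨ *-distribʳ-sum {k} c (λ _ → 1#) ⟨
    sum {k} (λ _ → 1#) * c  ≈⟨ *-congʳ (sum-replicate k) ⟩
    fromℕ k * c             ∎

  -- 0 ≤ |c − (a∙c / a∙a) a|², multiplied through by a∙a.
  cauchy-schwarz : ∀ {n} (a c : ℝ^ n) → (a ∙ c) * (a ∙ c) ≤ (a ∙ a) * (c ∙ c)
  cauchy-schwarz a c with a ∙ a ≈? 0#
  ... | yes aa≈0 = ≤-reflexive (begin-equality
    (a ∙ c) * (a ∙ c)  ≈⟨ *-congʳ (trans (∙-cong (∙-self-zero a aa≈0) (λ _ → refl)) (∙-zeroˡ c)) ⟩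
    0# * (a ∙ c)       ≈⟨ zeroˡ (a ∙ c) ⟩
    0#                 ≈⟨ zeroˡ (c ∙ c) ⟨
    0# * (c ∙ c)       ≈⟨ *-congʳ aa≈0 ⟨
    (a ∙ a) * (c ∙ c)  ∎)
  ... | no aa≉0 = begin
    l * l                                    ≤⟨ x≤x+y (*-nonneg (∙-self-nonneg a) (∙-self-nonneg z)) ⟩
    l * l + s * (z ∙ z)                      ≈⟨ +-congˡ (*-congˡ zz) ⟩
    l * l + s * (c ∙ c + k * l)
      ≈⟨ solve 4 (λ l s k q → l :* l :+ s :* (q :+ k :* l) := s :* q :+ (l :+ k :* s) :* l) refl l s k (c ∙ c) ⟩
    s * (c ∙ c) + (l + k * s) * l            ≈⟨ +-congˡ (trans (*-congʳ l+ks≈0) (zeroˡ l)) ⟩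
    s * (c ∙ c) + 0#                         ≈⟨ +-identityʳ _ ⟩
    s * (c ∙ c)                              ∎
    where
    l = a ∙ c
    s = a ∙ a
    k = - l * s ⁻¹
    z : ℝ^ _
    z j = c j + k * a j
    l+ks≈0 : l + k * s ≈ 0#
    l+ks≈0 = begin-equality
      l + - l * s ⁻¹ * s    ≈⟨ +-congˡ (*-assoc (- l) (s ⁻¹) s) ⟩
      l + - l * (s ⁻¹ * s)  ≈⟨ +-congˡ (*-congˡ (*-inverseˡ aa≉0)) ⟩
      l + - l * 1#          ≈⟨ +-congˡ (*-identityʳ (- l)) ⟩
      l - l                 ≈⟨ -‿inverseʳ l ⟩
      0#                    ∎
    az≈0 : a ∙ z ≈ 0#
    az≈0 = begin-equality
      a ∙ z              ≈⟨ ∙-comm a z ⟩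
      z ∙ a              ≈⟨ ∙-linearˡ c a a k ⟩
      c ∙ a + k * s      ≈⟨ +-congʳ (∙-comm c a) ⟩
      l + k * s          ≈⟨ l+ks≈0 ⟩
      0#                 ∎
    zz : z ∙ z ≈ c ∙ c + k * l
    zz = begin-equality
      z ∙ z                ≈⟨ ∙-linearˡ c a z k ⟩
      c ∙ z + k * (a ∙ z)  ≈⟨ +-congˡ (trans (*-congˡ az≈0) (zeroʳ k)) ⟩
      c ∙ z + 0#           ≈⟨ +-identityʳ (c ∙ z) ⟩
      c ∙ z                ≈⟨ ∙-comm c z ⟩
      z ∙ c                ≈⟨ ∙-linearˡ c a c k ⟩
      c ∙ c + k * (a ∙ c)  ∎

  Id-diagonal : ∀ {n} (k : Fin n) → Id k k ≈ 1#
  Id-diagonal zero    = refl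
  Id-diagonal (suc k) = Id-diagonal k

  Id-⊛ : ∀ {n} (x : ℝ^ n) → Id ⊛ x ≋ x
  Id-⊛ x i = trans (Diag-∙ (λ _ → 1#) x i) (*-identityˡ (x i))

  module _ {m n} (B : Matrix m n) (N : Matrix n n) where

    -- The i-th column of the orthogonal projection onto the range of B is B ⊛ (B ⊡ N) i.
    projection-column : N ⊡ gram B ≋ₘ Id → ∀ i x →
                        (B ⊛ (B ⊡ N) i) ∙ (B ⊛ x) ≈ B i ∙ x
    projection-column NG≋Id i x = begin-equality
      (B ⊛ u) ∙ (B ⊛ x)           ≈⟨ ᵀ-adjoint B u (B ⊛ x) ⟨
      u ∙ (B ᵀ ⊛ (B ⊛ x))         ≈⟨ ∙-cong (λ k → ∙-comm (B i) ((N ᵀ) k)) (λ k → sym (⊡-⊛-assoc (B ᵀ) B x k)) ⟩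
      (N ᵀ ⊛ B i) ∙ (gram B ⊛ x)  ≈⟨ ∙-comm (N ᵀ ⊛ B i) (gram B ⊛ x) ⟩
      -- The transpose moves to the other factor as `N`, next to `gram B`, where the left-inverse
      -- law applies.
      (gram B ⊛ x) ∙ (N ᵀ ⊛ B i)  ≈⟨ ᵀ-adjoint N (gram B ⊛ x) (B i) ⟩
      (N ⊛ (gram B ⊛ x)) ∙ B i    ≈⟨ ∙-cong (λ k → sym (⊡-⊛-assoc N (gram B) x k)) (λ _ → refl) ⟩
      ((N ⊡ gram B) ⊛ x) ∙ B i    ≈⟨ ∙-cong (λ k → ∙-cong (NG≋Id k) (λ _ → refl)) (λ _ → refl) ⟩
      (Id ⊛ x) ∙ B i              ≈⟨ ∙-cong (Id-⊛ x) (λ _ → refl) ⟩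
      x ∙ B i                     ≈⟨ ∙-comm x (B i) ⟩
      B i ∙ x                     ∎
      where
      u = (B ⊡ N) i

    -- Cyclicity of the trace: `B ⊡ N ⊡ B ᵀ` has the same trace as `gram B ⊡ N`, which is the
    -- identity of size `n`.
    trace-projection : gram B ⊡ N ≋ₘ Id → sum (diag (B ⊡ N ⊡ B ᵀ)) ≈ fromℕ n
    trace-projection GN≋Id = begin-equality
      sum (λ i → sum (λ k → (B ⊡ N) i k * B i k))  ≈⟨ ∑-comm (λ i k → (B ⊡ N) i k * B i k) ⟩
      sum (λ k → (B ⊛ (N ᵀ) k) ∙ (B ᵀ) k)          ≈⟨ sum-cong-≋ (λ k → ∙-comm (B ⊛ (N ᵀ) k) ((B ᵀ) k)) ⟩
      sum (λ k → (B ᵀ ⊛ (B ⊛ (N ᵀ) k)) k)          ≈⟨ sum-cong-≋ (λ k → sym (⊡-⊛-assoc (B ᵀ) B ((N ᵀ) k) k)) ⟩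
      sum (diag (gram B ⊡ N))                      ≈⟨ sum-cong-≋ (λ k → trans (GN≋Id k k) (Id-diagonal k)) ⟩
      sum {n} (λ _ → 1#)                           ≈⟨ sum-replicate n ⟩
      fromℕ n                                      ∎

  module _ {m n} (B : Matrix m n) (nd : NonDegenerate B) where

    private
      N : Matrix n n
      N = proj₁ (gram-invertible B nd)
      -- `B ⊛ u i` is the i-th column of the projection. Its squared length is its own i-th entry,
      -- the leverage score, by `Bu∙Bx≈b∙x` at `x = u i`.
      u : Fin m → ℝ^ n
      u = B ⊡ N
      Bu∙Bx≈b∙x : ∀ i x → (B ⊛ u i) ∙ (B ⊛ x) ≈ B i ∙ x
      Bu∙Bx≈b∙x = projection-column B N (proj₁ (proj₂ (gram-invertible B nd)))
      b∙u≈σ : ∀ i → B i ∙ u i ≈ σ B nd i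
      b∙u≈σ i = ∙-comm (B i) (u i)
      Bu∙Bu≈σ : ∀ i → (B ⊛ u i) ∙ (B ⊛ u i) ≈ σ B nd i
      Bu∙Bu≈σ i = trans (Bu∙Bx≈b∙x i (u i)) (b∙u≈σ i)

    -- The equality case of `σ-bound`: for `x = u i` the vector `B ⊛ x` is the projection column
    -- itself.
    σ-attained : ∀ i → ∃ λ x → B i ∙ x ≈ σ B nd i × (B ⊛ x) ∙ (B ⊛ x) ≈ σ B nd i
    σ-attained i = u i , b∙u≈σ i , Bu∙Bu≈σ i

    -- The projection fixes `B ⊛ x`, so `B i ∙ x` is the inner product of the i-th projection column
    -- with `B ⊛ x`, and Cauchy-Schwarz applies.
    σ-bound : ∀ i x → (B i ∙ x) * (B i ∙ x) ≤ σ B nd i * ((B ⊛ x) ∙ (B ⊛ x))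
    σ-bound i x = begin
      (B i ∙ x) * (B i ∙ x)
        ≈⟨ *-cong (Bu∙Bx≈b∙x i x) (Bu∙Bx≈b∙x i x) ⟨
      ((B ⊛ u i) ∙ (B ⊛ x)) * ((B ⊛ u i) ∙ (B ⊛ x))
        ≤⟨ cauchy-schwarz (B ⊛ u i) (B ⊛ x) ⟩
      ((B ⊛ u i) ∙ (B ⊛ u i)) * ((B ⊛ x) ∙ (B ⊛ x))
        ≈⟨ *-congʳ (Bu∙Bu≈σ i) ⟩
      σ B nd i * ((B ⊛ x) ∙ (B ⊛ x)) ∎

    -- If a score vanished, `σ-bound` at `x = B i` would make `B i ∙ B i` vanish, but no row is
    -- zero.
    σ-positive : Positive (σ B nd)
    σ-positive i = ≤-respʳ-≈ (Bu∙Bu≈σ i) (∙-self-nonneg (B ⊛ u i)) , λ 0≈σ →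
      proj₂ nd i (∙-self-zero (B i) (square-zero (≤-antisym
        (≤-respʳ-≈ (trans (*-congʳ (sym 0≈σ)) (zeroˡ _)) (σ-bound i (B i)))
        (square-nonneg (B i ∙ B i)))))

    sum-σ : sum (σ B nd) ≈ fromℕ n
    sum-σ = trace-projection B N (proj₂ (proj₂ (gram-invertible B nd)))

  -- Weighted energies and the quadratic form of the ellipsoid.

  energy : ∀ {m n} → ℝ^ m → Matrix m n → ℝ^ n → Carrier
  energy v A x = sum (λ i → v i * ((A ⊛ x) i * (A ⊛ x) i))

  module _ {m n} (A : Matrix m n) where

    energy-cong : ∀ {v v′ : ℝ^ m} {x y : ℝ^ n} → v ≋ v′ → x ≋ y → energy v A x ≈ energy v′ A y
    energy-cong v≋v′ x≋y = sum-cong-≋ (λ i → *-cong (v≋v′ i) (*-cong (Ax i) (Ax i)))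
      where
      Ax = λ i → ∙-cong {x = A i} (λ _ → refl) x≋y

    energy-scale : ∀ v c (x : ℝ^ n) → energy v A (λ j → c * x j) ≈ c * c * energy v A x
    energy-scale v c x = begin-equality
      energy v A (λ j → c * x j)
        ≈⟨ sum-cong-≋ (λ i → *-congˡ (*-cong (∙-scaleʳ (A i) x c) (∙-scaleʳ (A i) x c))) ⟩
      sum (λ i → v i * (c * (A i ∙ x) * (c * (A i ∙ x))))
        ≈⟨ sum-cong-≋ (λ i → solve 3 (λ v c y → v :* (c :* y :* (c :* y)) := c :* c :* (v :* (y :* y)))
             refl (v i) c (A i ∙ x)) ⟩
      sum (λ i → c * c * (v i * ((A i ∙ x) * (A i ∙ x))))
        ≈⟨ *-distribˡ-sum (c * c) (λ i → v i * ((A i ∙ x) * (A i ∙ x))) ⟨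
      c * c * energy v A x ∎

    energy-nonneg : ∀ {v : ℝ^ m} → Positive v → ∀ x → 0# ≤ energy v A x
    energy-nonneg v>0 x = sum-nonneg (λ i → *-nonneg (proj₁ (v>0 i)) (square-nonneg _))

    -- A vanishing sum of nonnegative terms has only zero terms; positive weights then give
    -- `A ⊛ x ≋ 𝟎`, and full column rank concludes.
    energy-positive : ∀ {v : ℝ^ m} → Positive v → FullColumnRank A →
                      ∀ x → ¬ (x ≋ 𝟎) → 0# < energy v A x
    energy-positive {v} v>0 fcr x x≉0 = energy-nonneg v>0 x , λ 0≈e → x≉0 (fcr x λ i →
      square-zero (integral (pos⇒≉0 (v>0 i)) (≤-antisym
        (≤-respʳ-≈ (sym 0≈e) (term≤sum (λ j → *-nonneg (proj₁ (v>0 j)) (square-nonneg _)) i))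
        (*-nonneg (proj₁ (v>0 i)) (square-nonneg _)))))

    quad≈energy : ∀ v (x : ℝ^ n) → quad (A ᵀ ⊡ Diag v ⊡ A) x ≈ energy v A x
    quad≈energy v x = begin-equality
      x ∙ ((A ᵀ ⊡ Diag v ⊡ A) ⊛ x)
        ≈⟨ ∙-cong {x = x} (λ _ → refl) (⊡-⊛-assoc (A ᵀ ⊡ Diag v) A x) ⟩
      x ∙ ((A ᵀ ⊡ Diag v) ⊛ (A ⊛ x))
        ≈⟨ ∙-cong {x = x} (λ _ → refl) (⊡-⊛-assoc (A ᵀ) (Diag v) (A ⊛ x)) ⟩
      x ∙ (A ᵀ ⊛ (Diag v ⊛ (A ⊛ x)))
        ≈⟨ ᵀ-adjoint A x (Diag v ⊛ (A ⊛ x)) ⟩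
      (A ⊛ x) ∙ (Diag v ⊛ (A ⊛ x))
        ≈⟨ sum-cong-≋ (λ i → trans (*-congˡ (Diag-∙ v (A ⊛ x) i))
             (solve 2 (λ y v → y :* (v :* y) := v :* (y :* y)) refl ((A ⊛ x) i) (v i))) ⟩
      energy v A x ∎

    quad-symmetric : ∀ v → let Q = A ᵀ ⊡ Diag v ⊡ A in (Q ᵀ) ≋ₘ Q
    quad-symmetric v i j = begin-equality
      (A ᵀ ⊡ Diag v) j ∙ (A ᵀ) i      ≈⟨ entry j i ⟩
      sum (λ k → v k * A k j * A k i)
        ≈⟨ sum-cong-≋ (λ k → solve 3 (λ v a b → v :* a :* b := v :* b :* a) refl (v k) (A k j) (A k i)) ⟩
      sum (λ k → v k * A k i * A k j)  ≈⟨ entry i j ⟨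
      (A ᵀ ⊡ Diag v) i ∙ (A ᵀ) j      ∎
      where
      Diag-sym : ∀ {l} (v : ℝ^ l) i j → Diag v i j ≈ Diag v j i
      Diag-sym v zero    zero    = refl
      Diag-sym v zero    (suc j) = refl
      Diag-sym v (suc i) zero    = refl
      Diag-sym v (suc i) (suc j) = Diag-sym (λ k → v (suc k)) i j
      entry : ∀ i j → (A ᵀ ⊡ Diag v) i ∙ (A ᵀ) j ≈ sum (λ k → v k * A k i * A k j)
      entry i j = ∙-cong {y = (A ᵀ) j} (λ k → begin-equality
        (A ᵀ) i ∙ (Diag v ᵀ) k  ≈⟨ ∙-comm ((A ᵀ) i) ((Diag v ᵀ) k) ⟩
        (Diag v ᵀ) k ∙ (A ᵀ) i  ≈⟨ ∙-cong {y = (A ᵀ) i} (λ l → Diag-sym v l k) (λ _ → refl) ⟩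
        Diag v k ∙ (A ᵀ) i      ≈⟨ Diag-∙ v ((A ᵀ) i) k ⟩
        v k * A k i             ∎) (λ _ → refl)

  -- Leverage scores of row rescalings.

  module _ {m n} {A B : Matrix m n} {v : ℝ^ m} (B≈vA : ∀ i x → B i ∙ x ≈ v i * (A i ∙ x)) where

    square-scaled : ∀ i x → (B i ∙ x) * (B i ∙ x) ≈ v i * v i * ((A i ∙ x) * (A i ∙ x))
    square-scaled i x = trans (*-cong (B≈vA i x) (B≈vA i x))
      (solve 2 (λ v y → v :* y :* (v :* y) := v :* v :* (y :* y)) refl (v i) (A i ∙ x))

    norm-scaled : ∀ x → (B ⊛ x) ∙ (B ⊛ x) ≈ energy (λ i → v i * v i) A x
    norm-scaled x = sum-cong-≋ (λ i → square-scaled i x)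

  -- The leverage scores s of the matrix with rows √(b i) A i, without the roots.
  record IsLeverageScore {m n} (b : ℝ^ m) (A : Matrix m n) (s : ℝ^ m) : Set where
    field
      positive : Positive s
      bound    : ∀ i x → b i * ((A i ∙ x) * (A i ∙ x)) ≤ s i * energy b A x
      attained : ∀ i → ∃ λ x → b i * ((A i ∙ x) * (A i ∙ x)) ≈ s i * s i × energy b A x ≈ s i
      total    : sum s ≈ fromℕ n

  -- Carries the Cauchy-Schwarz bound, its equality case and the trace from `B` over to `A`; each
  -- row factor enters only through its square.
  σ-isLeverageScore : ∀ {m n} {A B : Matrix m n} {v : ℝ^ m} (nd : NonDegenerate B) →
                      (∀ i x → B i ∙ x ≈ v i * (A i ∙ x)) →
                      IsLeverageScore (λ i → v i * v i) A (σ B nd)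
  σ-isLeverageScore {A = A} {B} nd B≈vA = record
    { positive = σ-positive B nd
    ; bound    = λ i x → ≤-respˡ-≈ (square-scaled B≈vA i x)
                   (≤-respʳ-≈ (*-congˡ (norm-scaled B≈vA x)) (σ-bound B nd i x))
    ; attained = λ i → let x , b∙x≈σ , Bx∙Bx≈σ = σ-attained B nd i in
                   x , trans (sym (square-scaled B≈vA i x)) (*-cong b∙x≈σ b∙x≈σ)
                     , trans (sym (norm-scaled B≈vA x)) Bx∙Bx≈σ
    ; total    = sum-σ B nd
    }

  -- For the exponent ½ this replaces the factors `w i ^ ½ * w i ^ ½` by `w i`.
  isLeverageScore-cong : ∀ {m n} {b b′ : ℝ^ m} {A : Matrix m n} {s : ℝ^ m} → b ≋ b′ →
                         IsLeverageScore b A s → IsLeverageScore b′ A s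
  isLeverageScore-cong {A = A} b≋b′ lev = record
    { positive = positive
    ; bound    = λ i x → ≤-respˡ-≈ (*-congʳ (b≋b′ i))
                   (≤-respʳ-≈ (*-congˡ (energy-cong A {x = x} b≋b′ (λ _ → refl))) (bound i x))
    ; attained = λ i → let x , bAx≈ss , e≈s = attained i in
                   x , trans (*-congʳ (sym (b≋b′ i))) bAx≈ss
                     , trans (sym (energy-cong A {x = x} b≋b′ (λ _ → refl))) e≈s
    ; total    = total
    }
    where open IsLeverageScore lev


  σ-scaled-isLeverageScore : ∀ {m n} (w : ℝ^ m) (w>0 : Positive w) a (A : Matrix m n) nd →
    IsLeverageScore (λ i → w i ^ a * w i ^ a) A (σ-scaled w w>0 a A nd)
  -- {A} is given explicitly because the conversion check is only fast when both
  -- nondegeneracy proofs are syntactically equal.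
  σ-scaled-isLeverageScore w w>0 a A nd = σ-isLeverageScore {B = Diag (w ^ᵛ a) ⊡ A}
    (Diag-nonDegenerate (λ i → ^-pos a (w>0 i)) {A} nd)
    (λ i x → trans (⊡-⊛-assoc (Diag (w ^ᵛ a)) A x i) (Diag-∙ (w ^ᵛ a) (A ⊛ x) i))

-- The constant and the interpolation inequality that produces it.

module LewisConstant (ℝ : RealNumbers) where
  open RealNumbers ℝ hiding (zero)
  open Matrices ℝ
  open RealProperties ℝ
  open LeverageScores ℝ
  open SemiringSum semiring using (sum; ∑-distrib-+; *-distribˡ-sum)
  open SemiringSolver commutativeSemiring using (solve; _:+_; _:*_; _:=_)
  open PosetReasoning (TotalOrder.poset totalOrder)

  module _ {α} (0<α : 0# < α) where

    1+α-pos : 0# < 1# + α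
    1+α-pos = +-pos 0<1 (proj₁ 0<α)

    -- Weights are split at `threshold m ⁻¹`. The small ones contribute at most `q / T` each, so by
    -- `threshold-identity` at most the fraction α / (1 + α) of `q` altogether, which can be
    -- absorbed.
    threshold : ℕ → Carrier
    threshold m = (1# + α ⁻¹) * fromℕ (suc m)

    threshold-pos : ∀ m → 0# < threshold m
    threshold-pos m = *-pos (+-pos 0<1 (proj₁ (⁻¹-pos 0<α))) (fromℕ-pos m)

    threshold-identity : ∀ m → (1# + α) * fromℕ (suc m) * threshold m ⁻¹ ≈ α
    threshold-identity m = begin-equality
      (1# + α) * M * T ⁻¹                  ≈⟨ *-congʳ (begin-equality
        (1# + α) * M                         ≈⟨ *-congʳ (+-comm 1# α) ⟩
        (α + 1#) * M                         ≈⟨ *-congʳ (+-cong (*-identityʳ α) (*-inverseʳ (pos⇒≉0 0<α))) ⟨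
        (α * 1# + α * α ⁻¹) * M              ≈⟨ *-congʳ (distribˡ α 1# (α ⁻¹)) ⟨
        α * (1# + α ⁻¹) * M                  ≈⟨ *-assoc α (1# + α ⁻¹) M ⟩
        α * T                                ∎) ⟩
      α * T * T ⁻¹                         ≈⟨ *-assoc α T (T ⁻¹) ⟩
      α * (T * T ⁻¹)                       ≈⟨ *-congˡ (*-inverseʳ (pos⇒≉0 (threshold-pos m))) ⟩
      α * 1#                               ≈⟨ *-identityʳ α ⟩
      α                                    ∎
      where
      M = fromℕ (suc m)
      T = threshold m

    -- `lewisConstant p (suc m)` unfolds to this at α = 2/p.
    interpolationConstant : ℕ → Carrier
    interpolationConstant m =
      (1# + α) ^ ((1# + α) ⁻¹) * threshold m ^ (α * (1# + α) ⁻¹)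

    interpolationConstant-pos : ∀ m → 0# < interpolationConstant m
    interpolationConstant-pos m = *-pos (^-pos _ 1+α-pos) (^-pos _ (threshold-pos m))

    -- Raising to the power `1# + α` clears the denominators of both exponents. The right-hand side
    -- is the factor that arises in `sum-interpolation`.
    interpolationConstant-^ : ∀ m →
      interpolationConstant m ^ (1# + α) ≈ (1# + α) * threshold m ^ α
    interpolationConstant-^ m = begin-equality
      (r ^ s * T ^ (α * s)) ^ r        ≈⟨ ^-distrib r (^-pos s 1+α-pos) (^-pos (α * s) 0<T) ⟩
      (r ^ s) ^ r * (T ^ (α * s)) ^ r  ≈⟨ *-cong (^-* s r 1+α-pos) (^-* (α * s) r 0<T) ⟨
      r ^ (s * r) * T ^ (α * s * r)    ≈⟨ *-cong (^-cong refl sr≈1) (^-cong refl αsr≈α) ⟩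
      r ^ 1# * T ^ α                   ≈⟨ *-congʳ (^-one 1+α-pos) ⟩
      r * T ^ α                        ∎
      where
      r = 1# + α
      s = r ⁻¹
      T = threshold m
      0<T = threshold-pos m
      sr≈1 : s * r ≈ 1#
      sr≈1 = *-inverseˡ (pos⇒≉0 1+α-pos)
      αsr≈α : α * s * r ≈ α
      αsr≈α = trans (*-assoc α s r) (trans (*-congˡ sr≈1) (*-identityʳ α))

    -- Large weights are absorbed by (T w) ^ α ≥ 1, small ones by w ≤ 1 / T.
    threshold-split : ∀ {T v b y q} → 0# < T → 0# < v → 0# ≤ b → 0# ≤ y → 0# ≤ q →
      b * v ^ α ≈ v → b * y ≤ v * q → b * y ≤ T ^ α * (v * y) + T ⁻¹ * q
    threshold-split {T} {v} {b} {y} {q} 0<T 0<v 0≤b 0≤y 0≤q bv^α≈v by≤vq with total 1# (T * v)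
    ... | inj₁ 1≤Tv = begin
      b * y                             ≤⟨ 1≤y⇒x≤y*x (*-nonneg 0≤b 0≤y) (1≤x⇒1≤x^a (proj₁ 0<α) 1≤Tv) ⟩
      (T * v) ^ α * (b * y)             ≈⟨ *-congʳ (^-distrib α 0<T 0<v) ⟩
      T ^ α * v ^ α * (b * y)
        ≈⟨ solve 4 (λ t u b y → t :* u :* (b :* y) := t :* (b :* u :* y)) refl (T ^ α) (v ^ α) b y ⟩
      T ^ α * (b * v ^ α * y)           ≈⟨ *-congˡ (*-congʳ bv^α≈v) ⟩
      T ^ α * (v * y)                   ≤⟨ x≤x+y (*-nonneg (proj₁ (⁻¹-pos 0<T)) 0≤q) ⟩
      T ^ α * (v * y) + T ⁻¹ * q        ∎
    ... | inj₂ Tv≤1 = begin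
      b * y                             ≤⟨ by≤vq ⟩
      v * q                             ≈⟨ *-congʳ (x⁻¹*[x*y]≈y 0<T v) ⟨
      T ⁻¹ * (T * v) * q                ≤⟨ *-monoˡ-≤ 0≤q (*-monoʳ-≤ (proj₁ (⁻¹-pos 0<T)) Tv≤1) ⟩
      T ⁻¹ * 1# * q                     ≈⟨ *-congʳ (*-identityʳ (T ⁻¹)) ⟩
      T ⁻¹ * q                          ≤⟨ x≤x+y (*-nonneg (proj₁ (^-pos α 0<T)) (*-nonneg (proj₁ 0<v) 0≤y)) ⟩
      T ⁻¹ * q + T ^ α * (v * y)        ≈⟨ +-comm _ _ ⟩
      T ^ α * (v * y) + T ⁻¹ * q        ∎

    module _ {m} {v b y : ℝ^ (suc m)} (v>0 : Positive v) (b>0 : Positive b) (y≥0 : ∀ i → 0# ≤ y i)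
             (bv^α≈v : ∀ i → b i * v i ^ α ≈ v i)
             (by≤v*sum : ∀ i → b i * y i ≤ v i * (b ∙ y))
      where

      private
        C = interpolationConstant m
        M = fromℕ (suc m)
        T = threshold m
        q = b ∙ y
        0<C = interpolationConstant-pos m
        0≤q : 0# ≤ q
        0≤q = sum-nonneg (λ i → *-nonneg (proj₁ (b>0 i)) (y≥0 i))

      -- Summing `threshold-split` over all rows and multiplying by `1# + α` leaves the term `α * q`
      -- on the right, which cancels against part of the left side.
      sum-interpolation : q ≤ C ^ (1# + α) * (v ∙ y)
      sum-interpolation = +-cancelˡ-≤ (α * q) (begin
        α * q + q
          ≈⟨ +-comm (α * q) q ⟩
        q + α * q
          ≈⟨ +-congʳ (*-identityˡ q) ⟨
        1# * q + α * q
          ≈⟨ distribʳ q 1# α ⟨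
        (1# + α) * q
          ≤⟨ *-monoʳ-≤ (proj₁ 1+α-pos) split-sum ⟩
        (1# + α) * (T ^ α * (v ∙ y) + M * (T ⁻¹ * q))
          ≈⟨ solve 6 (λ r t e M s q → r :* (t :* e :+ M :* (s :* q)) := r :* M :* s :* q :+ r :* t :* e)
               refl (1# + α) (T ^ α) (v ∙ y) M (T ⁻¹) q ⟩
        (1# + α) * M * T ⁻¹ * q + (1# + α) * T ^ α * (v ∙ y)
          ≈⟨ +-cong (*-congʳ (threshold-identity m)) (*-congʳ (sym (interpolationConstant-^ m))) ⟩
        α * q + C ^ (1# + α) * (v ∙ y) ∎)
        where
        split-sum : q ≤ T ^ α * (v ∙ y) + M * (T ⁻¹ * q)
        split-sum = begin
          q
            ≤⟨ sum-mono-≤ (λ i → threshold-split (threshold-pos m) (v>0 i) (proj₁ (b>0 i)) (y≥0 i) 0≤q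
                                   (bv^α≈v i) (by≤v*sum i)) ⟩
          sum (λ i → T ^ α * (v i * y i) + T ⁻¹ * q)
            ≈⟨ ∑-distrib-+ (λ i → T ^ α * (v i * y i)) (λ _ → T ⁻¹ * q) ⟩
          sum (λ i → T ^ α * (v i * y i)) + sum {suc m} (λ _ → T ⁻¹ * q)
            ≈⟨ +-cong (sym (*-distribˡ-sum (T ^ α) (λ i → v i * y i))) (sum-const (suc m) (T ⁻¹ * q)) ⟩
          T ^ α * (v ∙ y) + M * (T ⁻¹ * q) ∎

      -- If `C * v i` is at least 1, the i-th term of `v ∙ y` suffices alone; otherwise the
      -- smallness of `v i` pays for the larger constant in `sum-interpolation`.
      interpolation : ∀ i → y i ≤ C * (v ∙ y)
      interpolation i with total 1# (C * v i)
      ... | inj₁ 1≤Cv = begin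
        y i              ≤⟨ 1≤y⇒x≤y*x (y≥0 i) 1≤Cv ⟩
        C * v i * y i    ≈⟨ *-assoc C (v i) (y i) ⟩
        C * (v i * y i)  ≤⟨ *-monoʳ-≤ (proj₁ 0<C) (term≤sum vy≥0 i) ⟩
        C * (v ∙ y)      ∎
        where
        vy≥0 : ∀ j → 0# ≤ v j * y j
        vy≥0 j = *-nonneg (proj₁ (v>0 j)) (y≥0 j)
      ... | inj₂ Cv≤1 = begin
        y i                                    ≤⟨ y≤v^αq ⟩
        v i ^ α * q                            ≤⟨ *-monoʳ-≤ (proj₁ 0<v^α) sum-interpolation ⟩
        v i ^ α * (C ^ (1# + α) * e)
          -- One factor `C` is kept; the remaining `C ^ α` joins `v i ^ α` to form `(C * v i) ^ α`,
          -- which is at most 1.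
          ≈⟨ *-congˡ (*-congʳ (trans (^-+ 1# α 0<C) (*-congʳ (^-one 0<C)))) ⟩
        v i ^ α * (C * C ^ α * e)
          ≈⟨ solve 4 (λ u c d e → u :* (c :* d :* e) := d :* u :* (c :* e)) refl (v i ^ α) C (C ^ α) e ⟩
        C ^ α * v i ^ α * (C * e)              ≈⟨ *-congʳ (^-distrib α 0<C (v>0 i)) ⟨
        (C * v i) ^ α * (C * e)
          ≤⟨ y≤1⇒y*x≤x (*-nonneg (proj₁ 0<C) 0≤e)
               (x≤1⇒x^a≤1 (proj₁ 0<α) (*-pos 0<C (v>0 i)) Cv≤1) ⟩
        C * e                                  ∎
        where
        e = v ∙ y
        0≤e : 0# ≤ e
        0≤e = sum-nonneg (λ j → *-nonneg (proj₁ (v>0 j)) (y≥0 j))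
        0<v^α : 0# < v i ^ α
        0<v^α = ^-pos α (v>0 i)
        -- Multiplying `b i * y i ≤ v i * q` by `v i ^ α` turns `b i` into `v i`, which then
        -- cancels.
        y≤v^αq : y i ≤ v i ^ α * q
        y≤v^αq = *-cancelˡ-≤ (v>0 i) (begin
          v i * y i                ≈⟨ *-congʳ (bv^α≈v i) ⟨
          b i * v i ^ α * y i
            ≈⟨ solve 3 (λ b u y → b :* u :* y := u :* (b :* y)) refl (b i) (v i ^ α) (y i) ⟩
          v i ^ α * (b i * y i)    ≤⟨ *-monoʳ-≤ (proj₁ 0<v^α) (by≤v*sum i) ⟩
          v i ^ α * (v i * q)
            ≈⟨ solve 3 (λ u v q → u :* (v :* q) := v :* (u :* q)) refl (v i ^ α) (v i) q ⟩
          v i * (v i ^ α * q)      ∎)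

-- The ellipsoid and the ball in terms of squared entries of `A ⊛ x`.

module LewisEllipsoid (ℝ : RealNumbers) where
  open RealNumbers ℝ hiding (zero; total)
  open Matrices ℝ
  open RealProperties ℝ
  open LeverageScores ℝ
  open LewisConstant ℝ
  open SemiringSum semiring using (sum; sum-cong-≋)
  open SemiringSolver commutativeSemiring using (solve; _:+_; _:*_; _:=_)
  open PosetReasoning (TotalOrder.poset totalOrder)

  [x⁻¹*x⁻¹]*y≤1 : ∀ {x y} → 0# < x → y ≤ x * x → x ⁻¹ * x ⁻¹ * y ≤ 1#
  [x⁻¹*x⁻¹]*y≤1 {x} {y} 0<x y≤xx = begin
    x ⁻¹ * x ⁻¹ * y        ≤⟨ *-monoʳ-≤ (square-nonneg (x ⁻¹)) y≤xx ⟩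
    x ⁻¹ * x ⁻¹ * (x * x)
      ≈⟨ solve 2 (λ z x → z :* z :* (x :* x) := (z :* x) :* (z :* x)) refl (x ⁻¹) x ⟩
    x ⁻¹ * x * (x ⁻¹ * x)  ≈⟨ *-cong x⁻¹x≈1 x⁻¹x≈1 ⟩
    1# * 1#                ≈⟨ *-identityˡ 1# ⟩
    1#                     ∎
    where
    x⁻¹x≈1 = *-inverseˡ (pos⇒≉0 0<x)

  •-intro : ∀ {n} {S : Pred (ℝ^ n) _} {c x} → 0# < c → S (λ j → c ⁻¹ * x j) → (c • S) x
  •-intro {c = c} {x} 0<c Sy = _ , Sy , λ j → begin-equality
    x j                 ≈⟨ *-identityˡ (x j) ⟨
    1# * x j            ≈⟨ *-congʳ (*-inverseʳ (pos⇒≉0 0<c)) ⟨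
    c * c ⁻¹ * x j      ≈⟨ *-assoc c (c ⁻¹) (x j) ⟩
    c * (c ⁻¹ * x j)    ∎

  module _ {m n} (A : Matrix (suc m) n) where

    square : Fin (suc m) → ℝ^ n → Carrier
    square i x = (A i ∙ x) * (A i ∙ x)

    square-scale : ∀ i c x → square i (λ j → c * x j) ≈ c * c * square i x
    square-scale i c x = trans (*-cong (∙-scaleʳ (A i) x c) (∙-scaleʳ (A i) x c))
      (solve 2 (λ c y → c :* y :* (c :* y) := c :* c :* (y :* y)) refl c (A i ∙ x))

    square-cong : ∀ i {x y} → x ≋ y → square i x ≈ square i y
    square-cong i x≋y = *-cong Ax Ax
      where
      Ax = ∙-cong {x = A i} (λ _ → refl) x≋y

    ∞-ball⇒square≤1 : ∀ {x} → ∞-ball A x → ∀ i → square i x ≤ 1#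
    ∞-ball⇒square≤1 x∈K i = ∣x∣≤1⇒x*x≤1 (≤-trans (x≤max _ i) x∈K)

    square≤1⇒∞-ball : ∀ {x} → (∀ i → square i x ≤ 1#) → ∞-ball A x
    square≤1⇒∞-ball sq≤1 = max-lub _ (λ i → x*x≤1⇒∣x∣≤1 (sq≤1 i))

    E⇒energy≤1 : ∀ w {x} → lewisEllipsoid A w x → energy w A x ≤ 1#
    E⇒energy≤1 w {x} = ≤-respˡ-≈ (quad≈energy A w x)

    energy≤1⇒E : ∀ w {x} → energy w A x ≤ 1# → lewisEllipsoid A w x
    energy≤1⇒E w {x} = ≤-respˡ-≈ (sym (quad≈energy A w x))

    -- The smallest r with E contained in √r K.

    module _ {w b s : ℝ^ (suc m)} (w>0 : Positive w) (lev : IsLeverageScore b A s) (b≋w : b ≋ w) where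

      open IsLeverageScore (isLeverageScore-cong b≋w lev)

      private
        E = lewisEllipsoid A w
        K = ∞-ball A
        Q = energy w A
        ratio : ℝ^ (suc m)
        ratio i = s i * w i ⁻¹

      w*ratio≈s : ∀ i → w i * ratio i ≈ s i
      w*ratio≈s i = begin-equality
        w i * (s i * w i ⁻¹)  ≈⟨ *-congˡ (*-comm (s i) (w i ⁻¹)) ⟩
        w i * (w i ⁻¹ * s i)  ≈⟨ *-assoc (w i) (w i ⁻¹) (s i) ⟨
        w i * w i ⁻¹ * s i    ≈⟨ *-congʳ (*-inverseʳ (pos⇒≉0 (w>0 i))) ⟩
        1# * s i              ≈⟨ *-identityˡ (s i) ⟩
        s i                   ∎

      ratio-bound : ∀ i x → square i x ≤ ratio i * Q x
      ratio-bound i x = *-cancelˡ-≤ (w>0 i) (begin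
        w i * square i x       ≤⟨ bound i x ⟩
        s i * Q x              ≈⟨ *-congʳ (w*ratio≈s i) ⟨
        w i * ratio i * Q x    ≈⟨ *-assoc (w i) (ratio i) (Q x) ⟩
        w i * (ratio i * Q x)  ∎)

      -- The extremal vector of the leverage bound has energy `s i`; dividing it by `√ (s i)` puts
      -- it on the boundary of the ellipsoid.
      ratio-attained : ∀ i → ∃ λ x → square i x ≈ ratio i × Q x ≈ 1#
      ratio-attained i with attained i
      ... | u , wu≈ss , Qu≈s = (λ j → d * u j) , square≈ratio , Qx≈1
        where
        d = √ (s i) ⁻¹
        dds≈1 : d * d * s i ≈ 1#
        dds≈1 = begin-equality
          d * d * s i        ≈⟨ *-congˡ (√-square (proj₁ (positive i))) ⟨
          d * d * (r * r)
            ≈⟨ solve 2 (λ d r → d :* d :* (r :* r) := d :* (r :* (d :* r))) refl d r ⟩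
          d * (r * (d * r))  ≈⟨ x⁻¹*[x*y]≈y 0<r (d * r) ⟩
          d * r              ≈⟨ *-inverseˡ (pos⇒≉0 0<r) ⟩
          1#                 ∎
          where
          r = √ (s i)
          0<r = ^-pos ½ (positive i)
        Qx≈1 : Q (λ j → d * u j) ≈ 1#
        Qx≈1 = begin-equality
          Q (λ j → d * u j)  ≈⟨ energy-scale A w d u ⟩
          d * d * Q u        ≈⟨ *-congˡ Qu≈s ⟩
          d * d * s i        ≈⟨ dds≈1 ⟩
          1#                 ∎
        square≈ratio : square i (λ j → d * u j) ≈ ratio i
        square≈ratio = *-cancelˡ (w>0 i) (begin-equality
          w i * square i (λ j → d * u j)  ≈⟨ *-congˡ (square-scale i d u) ⟩
          w i * (d * d * square i u)
            ≈⟨ solve 3 (λ w d y → w :* (d :* d :* y) := d :* d :* (w :* y)) refl (w i) d (square i u) ⟩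
          d * d * (w i * square i u)      ≈⟨ *-congˡ wu≈ss ⟩
          d * d * (s i * s i)             ≈⟨ *-assoc (d * d) (s i) (s i) ⟨
          d * d * s i * s i               ≈⟨ *-congʳ dds≈1 ⟩
          1# * s i                        ≈⟨ *-identityˡ (s i) ⟩
          s i                             ≈⟨ w*ratio≈s i ⟨
          w i * ratio i                   ∎)

      max-ratio-pos : 0# < max ratio
      max-ratio-pos =
        pos-≤ (*-pos (positive zero) (⁻¹-pos (w>0 zero))) (x≤max ratio zero)

      max-ratio-inclusion : E ⊆ √ (max ratio) • K
      max-ratio-inclusion {x} x∈E = •-intro 0<√R (square≤1⇒∞-ball λ i →
        ≤-respˡ-≈ (sym (square-scale i (√R ⁻¹) x)) ([x⁻¹*x⁻¹]*y≤1 0<√R (begin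
          square i x     ≤⟨ ratio-bound i x ⟩
          ratio i * Q x  ≤⟨ *-monoˡ-≤ (energy-nonneg A w>0 x) (x≤max ratio i) ⟩
          R * Q x        ≤⟨ *-monoʳ-≤ (proj₁ max-ratio-pos) (E⇒energy≤1 w x∈E) ⟩
          R * 1#         ≈⟨ *-identityʳ R ⟩
          R              ≈⟨ √-square (proj₁ max-ratio-pos) ⟨
          √R * √R        ∎)))
        where
        R = max ratio
        √R = √ R
        0<√R = ^-pos ½ max-ratio-pos

      -- For leastness, the vector from `ratio-attained` lies in `E`, and its membership in
      -- `√ r • K` forces `ratio i ≤ r` for every row.
      max-ratio-least : IsLeast (λ r → 0# ≤ r × lewisEllipsoid A w ⊆ √ r • ∞-ball A)
                                (max (λ i → s i * w i ⁻¹))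
      max-ratio-least = (proj₁ max-ratio-pos , max-ratio-inclusion) , λ (0≤r , E⊆√rK) →
        max-lub ratio (λ i → bounded 0≤r E⊆√rK i)
        where
        bounded : ∀ {r} → 0# ≤ r → E ⊆ √ r • K → ∀ i → ratio i ≤ r
        bounded {r} 0≤r E⊆√rK i =
          let x , sq≈ratio , Qx≈1 = ratio-attained i
              y , y∈K , x≋√ry = E⊆√rK (energy≤1⇒E w (≤-reflexive Qx≈1))
          in begin
          ratio i                      ≈⟨ sq≈ratio ⟨
          square i x                   ≈⟨ square-cong i x≋√ry ⟩
          square i (λ j → √ r * y j)   ≈⟨ square-scale i (√ r) y ⟩
          √ r * √ r * square i y       ≈⟨ *-congʳ (√-square 0≤r) ⟩
          r * square i y               ≤⟨ *-monoʳ-≤ 0≤r (∞-ball⇒square≤1 y∈K i) ⟩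
          r * 1#                       ≈⟨ *-identityʳ r ⟩
          r                            ∎

    -- From a bound on squared entries to a rounding.

    module _ (fcr : FullColumnRank A) {w : ℝ^ (suc m)} (w>0 : Positive w) where

      private
        E = lewisEllipsoid A w
        K = ∞-ball A
        Q = energy w A
        Mat = A ᵀ ⊡ Diag w ⊡ A

      -- Shrinking the ellipsoid by `√ C` multiplies its defining matrix by `C`.
      scaled-ellipsoid : ∀ {C} → 0# < C → IsEllipsoid ((C ^ (- ½)) • E)
      scaled-ellipsoid {C} 0<C = P , (symmetric , definite) , (to , from)
        where
        g = C ^ (- ½)
        P : Matrix n n
        P i j = C * Mat i j
        √Cg≈1 : √ C * g ≈ 1#
        √Cg≈1 = ^-inverseʳ ½ 0<C
        √C√C≈C = √-square (proj₁ 0<C)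
        symmetric : (P ᵀ) ≋ₘ P
        symmetric i j = *-congˡ (quad-symmetric A w i j)
        quad-P : ∀ x → quad P x ≈ C * Q x
        quad-P x = begin-equality
          x ∙ (P ⊛ x)
            ≈⟨ ∙-cong {x = x} (λ _ → refl) (λ i →
                 trans (∙-comm (P i) x) (trans (∙-scaleʳ x (Mat i) C) (*-congˡ (∙-comm x (Mat i))))) ⟩
          x ∙ (λ i → C * (Mat ⊛ x) i)  ≈⟨ ∙-scaleʳ x (Mat ⊛ x) C ⟩
          C * quad Mat x               ≈⟨ *-congˡ (quad≈energy A w x) ⟩
          C * Q x                      ∎
        definite : ∀ x → ¬ (x ≋ 𝟎) → 0# < quad P x
        definite x x≉0 = pos-resp-≈ (sym (quad-P x))
          (*-pos 0<C (energy-positive A w>0 fcr x x≉0))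
        to : (g • E) ⊆ (λ x → quad P x ≤ 1#)
        to {x} (y , y∈E , x≋gy) = begin
          quad P x                           ≈⟨ quad-P x ⟩
          C * Q x                            ≈⟨ *-congˡ (trans (energy-cong A {w} (λ _ → refl) x≋gy)
                                                             (energy-scale A w g y)) ⟩
          C * (g * g * Q y)                  ≈⟨ *-congʳ √C√C≈C ⟨
          √ C * √ C * (g * g * Q y)
            ≈⟨ solve 3 (λ h g e → h :* h :* (g :* g :* e) := h :* g :* (h :* g) :* e) refl (√ C) g (Q y) ⟩
          √ C * g * (√ C * g) * Q y          ≈⟨ *-congʳ (trans (*-cong √Cg≈1 √Cg≈1) (*-identityˡ 1#)) ⟩
          1# * Q y                           ≈⟨ *-identityˡ (Q y) ⟩
          Q y                                ≤⟨ E⇒energy≤1 w y∈E ⟩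
          1#                                 ∎
        from : (λ x → quad P x ≤ 1#) ⊆ (g • E)
        from {x} Px≤1 = (λ j → √ C * x j) , energy≤1⇒E w (begin
            Q (λ j → √ C * x j)  ≈⟨ energy-scale A w (√ C) x ⟩
            √ C * √ C * Q x      ≈⟨ *-congʳ √C√C≈C ⟩
            C * Q x              ≈⟨ quad-P x ⟨
            quad P x             ≤⟨ Px≤1 ⟩
            1#                   ∎)
          , λ j → begin-equality
            x j                  ≈⟨ *-identityˡ (x j) ⟨
            1# * x j             ≈⟨ *-congʳ (trans (*-comm g (√ C)) √Cg≈1) ⟨
            g * √ C * x j        ≈⟨ *-assoc g (√ C) (x j) ⟩
            g * (√ C * x j)      ∎

      -- Shrinking by `√ C` divides the energy by `C`, which cancels the constant in the bound on
      -- `square i x`. On the outer side the lost factor is restored by `√ (C * N) = √ C * √ N`.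
      rounding : ∀ {C N} → 0# < C → 0# < N → (∀ i x → square i x ≤ C * Q x) → K ⊆ √ N • E →
                 IsRounding ((C ^ (- ½)) • E) K (√ (C * N))
      rounding {C} {N} 0<C 0<N sq≤CQ K⊆√NE = record
        { ellipsoid = scaled-ellipsoid 0<C
        ; inner     = inner
        ; outer     = outer
        }
        where
        g = C ^ (- ½)
        √Cg≈1 : √ C * g ≈ 1#
        √Cg≈1 = ^-inverseʳ ½ 0<C
        inner : (g • E) ⊆ K
        inner {x} (y , y∈E , x≋gy) = square≤1⇒∞-ball λ i → begin
          square i x                    ≈⟨ trans (square-cong i x≋gy) (square-scale i g y) ⟩
          g * g * square i y            ≤⟨ *-monoʳ-≤ (square-nonneg g) (sq≤CQ i y) ⟩
          g * g * (C * Q y)             ≈⟨ *-congˡ (*-congʳ (√-square (proj₁ 0<C))) ⟨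
          g * g * (√ C * √ C * Q y)
            ≈⟨ solve 3 (λ h g e → g :* g :* (h :* h :* e) := h :* g :* (h :* g) :* e) refl (√ C) g (Q y) ⟩
          √ C * g * (√ C * g) * Q y     ≈⟨ *-congʳ (trans (*-cong √Cg≈1 √Cg≈1) (*-identityˡ 1#)) ⟩
          1# * Q y                      ≈⟨ *-identityˡ (Q y) ⟩
          Q y                           ≤⟨ E⇒energy≤1 w y∈E ⟩
          1#                            ∎
        outer : K ⊆ √ (C * N) • (g • E)
        outer {x} x∈K with K⊆√NE x∈K
        ... | y , y∈E , x≋√Ny = (λ j → g * y j) , (y , y∈E , λ _ → refl) , λ j → begin-equality
          x j                       ≈⟨ x≋√Ny j ⟩
          √ N * y j                 ≈⟨ *-identityˡ _ ⟨
          1# * (√ N * y j)          ≈⟨ *-congʳ √Cg≈1 ⟨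
          √ C * g * (√ N * y j)
            ≈⟨ solve 4 (λ h g k y → h :* g :* (k :* y) := h :* k :* (g :* y)) refl (√ C) g (√ N) (y j) ⟩
          √ C * √ N * (g * y j)     ≈⟨ *-congʳ (^-distrib ½ 0<C 0<N) ⟨
          √ (C * N) * (g * y j)     ∎

  -- Without columns, the row at index `zero` would be a zero row.
  nonDegenerate⇒columns-pos : ∀ {m n} (A : Matrix (suc m) n) → NonDegenerate A → 0# < fromℕ n
  nonDegenerate⇒columns-pos {n = zero}  A (_ , nz) = contradiction (λ ()) (nz zero)
  nonDegenerate⇒columns-pos {n = suc n} A _        = fromℕ-pos n

  -- Consequences of the Lewis fixed point.

  module _ {m n} (A : Matrix (suc m) n) {w b s : ℝ^ (suc m)} (w>0 : Positive w)
           (w≋s : w ≋ s) (lev : IsLeverageScore b A s) where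

    open IsLeverageScore lev

    private
      E = lewisEllipsoid A w
      K = ∞-ball A
      Q = energy w A

    -- On the ball all squared entries are at most 1, so the energy is at most the sum of the
    -- weights, which is the sum of the leverage scores, `n`.
    ∞-ball⊆√n•E : 0# < fromℕ n → K ⊆ √ (fromℕ n) • E
    ∞-ball⊆√n•E 0<n {x} x∈K = •-intro 0<√n (energy≤1⇒E A w (begin
      Q (λ j → √n ⁻¹ * x j)  ≈⟨ energy-scale A w (√n ⁻¹) x ⟩
      √n ⁻¹ * √n ⁻¹ * Q x    ≤⟨ [x⁻¹*x⁻¹]*y≤1 0<√n Q≤n ⟩
      1#                     ∎))
      where
      √n = √ (fromℕ n)
      0<√n = ^-pos ½ 0<n
      Q≤n : Q x ≤ √n * √n
      Q≤n = begin
        Q x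
          ≤⟨ sum-mono-≤ (λ i → *-monoʳ-≤ (proj₁ (w>0 i)) (∞-ball⇒square≤1 A x∈K i)) ⟩
        sum (λ i → w i * 1#)
          ≈⟨ sum-cong-≋ (λ i → trans (*-identityʳ (w i)) (w≋s i)) ⟩
        sum s
          ≈⟨ total ⟩
        fromℕ n
          ≈⟨ √-square (proj₁ 0<n) ⟨
        √n * √n ∎

    -- With `s` replaced by `w`, the leverage bound is the hypothesis `by≤v*sum` of `interpolation`
    -- for the squared entries.
    square-bound : ∀ {α} (0<α : 0# < α) → Positive b → (∀ i → b i * w i ^ α ≈ w i) →
                   ∀ i x → square A i x ≤ interpolationConstant 0<α m * Q x
    square-bound 0<α b>0 bw^α≈w i x = interpolation 0<α w>0 b>0
      (λ j → square-nonneg (A j ∙ x)) bw^α≈w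
      (λ j → ≤-respʳ-≈ (*-congʳ (sym (w≋s j))) (bound j x)) i

  module _ {p v : Carrier} (0<v : 0# < v) where

    private
      q = p ⁻¹
      a = ½ + - q
      α = 2# * q

    -- The exponents satisfy 2 (1/2 - 1/p) + 2/p = 1. This supplies `b i * w i ^ α ≈ w i` for the
    -- squared Lewis row factors.
    lewis-exponents : v ^ a * v ^ a * v ^ α ≈ v
    lewis-exponents = begin-equality
      v ^ a * v ^ a * v ^ α  ≈⟨ *-congʳ (^-+ a a 0<v) ⟨
      v ^ (a + a) * v ^ α    ≈⟨ ^-+ (a + a) α 0<v ⟨
      v ^ (a + a + α)        ≈⟨ ^-cong refl exponent ⟩
      v ^ 1#                 ≈⟨ ^-one 0<v ⟩
      v                      ∎
      where
      exponent : a + a + α ≈ 1#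
      exponent = begin-equality
        (½ + - q) + (½ + - q) + 2# * q
          ≈⟨ +-congˡ (trans (distribʳ q 1# 1#) (+-cong (*-identityˡ q) (*-identityˡ q))) ⟩
        (½ + - q) + (½ + - q) + (q + q)
          ≈⟨ solve 3 (λ h r q → (h :+ r) :+ (h :+ r) :+ (q :+ q) := (h :+ h) :+ ((r :+ q) :+ (r :+ q)))
               refl ½ (- q) q ⟩
        (½ + ½) + ((- q + q) + (- q + q))
          ≈⟨ +-cong ½+½≈1 (trans (+-cong (-‿inverseˡ q) (-‿inverseˡ q)) (+-identityˡ 0#)) ⟩
        1# + 0#
          ≈⟨ +-identityʳ 1# ⟩
        1# ∎

-- The three claims for Lewis weights: exponent ½ for the least ratio, the Lewis exponent for the
-- other two.

lemma27 :
    (ℝ : RealNumbers) → let open RealNumbers ℝ in let open Matrices ℝ in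
    (m n : ℕ) (A : Matrix (suc m) n) (nd : NonDegenerate A)
    (p : Carrier) → 0# < p →
    (w : ℝ^ (suc m)) (lewis : IsLewisWeight p A nd w) →
    let E = lewisEllipsoid A w
        K = ∞-ball A
        R = max (λ i → σ-scaled w (IsLewisWeight.positive lewis) ½ A nd i * (w i) ⁻¹)
        C = lewisConstant p (suc m)
    in IsLeast (λ r → 0# ≤ r × E ⊆ √ r • K) R
     × K ⊆ √ (fromℕ n) • E
     × IsRounding ((C ^ (- ½)) • E) K (√ (C * fromℕ n))
lemma27 ℝ m n A nd p 0<p w lewis = least-ratio , K⊆√nE , rounds
  where
  open RealNumbers ℝ
  open Matrices ℝ
  open RealProperties ℝ
  open LeverageScores ℝ
  open LewisConstant ℝ
  open LewisEllipsoid ℝ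
  open IsLewisWeight lewis

  0<α : 0# < 2# * p ⁻¹
  0<α = *-pos 2#-pos (⁻¹-pos 0<p)

  0<n : 0# < fromℕ n
  0<n = nonDegenerate⇒columns-pos A nd

  instance
    ½≡½ : ½ ≡ ½
    ½≡½ = ≡.refl

  -- The exponent is left to unification with the goal, and the equation to instance
  -- search afterwards: comparing σ-scaled at two differently elaborated copies of ½
  -- would unfold the matrix inversion and its correctness proof.
  least-ratio : ∀ {a} → {{a ≡ ½}} → IsLeast (λ r → 0# ≤ r × lewisEllipsoid A w ⊆ √ r • ∞-ball A)
                                            (max (λ i → σ-scaled w positive a A nd i * w i ⁻¹))
  least-ratio {a} {{a≡½}} =
    max-ratio-least A {w = w} positive (σ-scaled-isLeverageScore w positive a A nd) λ i →
      trans (*-cong (^-cong refl a≈½) (^-cong refl a≈½)) (√-square (proj₁ (positive i)))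
    where a≈½ = reflexive a≡½

  K⊆√nE : ∞-ball A ⊆ √ (fromℕ n) • lewisEllipsoid A w
  K⊆√nE = ∞-ball⊆√n•E A positive fixedPoint (σ-scaled-isLeverageScore w positive _ A nd) 0<n

  rounds : IsRounding ((lewisConstant p (suc m) ^ (- ½)) • lewisEllipsoid A w) (∞-ball A)
                      (√ (lewisConstant p (suc m) * fromℕ n))
  rounds = rounding A (proj₁ nd) positive (interpolationConstant-pos 0<α m) 0<n
    (square-bound A positive fixedPoint (σ-scaled-isLeverageScore w positive _ A nd) 0<α
      (λ i → *-pos (^-pos _ (positive i)) (^-pos _ (positive i)))
      (λ i → lewis-exponents (positive i)))
    K⊆√nE
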